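{- Let $k\ge 3$ and $n\ge 2\lceil \log_{2}(k-1)\rceil + 4$, and let $\mathcal A$ be a $k$-wise eventown on $[n]$. If $|\mathcal A|> \frac{3}{4}2^{\lfloor n/2\rfloor}+(k-1)n$, then $\mathcal A$ is a subfamily of a family of one of the following two types: (i) there are $\lfloor n/2\rfloor$ pairwise disjoint subsets $B_1,\ldots,B_{\lfloor n/2\rfloor}$ of $[n]$, each of size $2$, and the family is $\mathcal B=\{\bigcup_{i\in S}B_i : S\subseteq[\lfloor n/2\rfloor]\}$; (ii) $n$ is odd, $B_1,\ldots,B_{\lfloor n/2\rfloor}$ and $\mathcal B$ are as in (i), $i\in[n]$ is the unique element not covered by $B_1,\ldots,B_{\lfloor n/2\rfloor}$, $C_1,\ldots,C_{k-1}$ are $k-1$ distinct sets of $\mathcal B$, and the family is $\mathcal B\cup\{C_1\cup\{i\},\ldots,C_{k-1}\cup\{i\}\}$.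
   Context: A family $\mathcal A=\{A_1,\ldots,A_m\}$ of distinct subsets of $[n]=\{1,\ldots,n\}$ is a $k$-wise eventown if $\left|\bigcap_{i\in S}A_i\right|$ is even for every $S\subseteq[m]$ with $|S|=k$. -}

module Defs where

open import Data.Nat using (ℕ; zero; suc; _+_; _*_; _∸_; _^_; _<_; _≤_; ⌊_/2⌋)
open import Data.Nat.Divisibility using (_∣_)
open import Data.Nat.Logarithm using (⌈log₂_⌉)
open import Data.Bool using (Bool; true; false; if_then_else_)
open import Data.Fin using (Fin; zero; suc)
open import Data.Fin.Subset using (Subset; _∩_; _∪_; ⊤; ⊥; ⁅_⁆; ∣_∣; _∈_; _∉_)
open import Data.Vec using ([]; _∷_)
open import Data.Product using (Σ; ∃; _×_; _,_)
open import Data.Sum using (_⊎_)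
open import Relation.Binary.PropositionalEquality using (_≡_; _≢_)
open import Relation.Nullary using (¬_)
open import Function using (_∘_)
open import Function.Definitions using (Injective)

⋂[_]_ : ∀ {m n} → Subset m → (Fin m → Subset n) → Subset n
⋂[_]_ {zero}  []      A = ⊤
⋂[_]_ {suc m} (b ∷ S) A = (if b then A zero else ⊤) ∩ (⋂[ S ] (A ∘ suc))

⋃[_]_ : ∀ {m n} → Subset m → (Fin m → Subset n) → Subset n
⋃[_]_ {zero}  []      B = ⊥
⋃[_]_ {suc m} (b ∷ S) B = (if b then B zero else ⊥) ∪ (⋃[ S ] (B ∘ suc))

-- A family {A_1,…,A_m} of distinct subsets of [n] is given as an injective map Fin m → Subset n.
-- k-wise eventown: every k-wise intersection has even size.
IsKWiseEventown : ∀ {m n} → ℕ → (Fin m → Subset n) → Set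
IsKWiseEventown {m} k A =
  Injective _≡_ _≡_ A × ((S : Subset m) → ∣ S ∣ ≡ k → 2 ∣ ∣ ⋂[ S ] A ∣)

IsPairing : ∀ {n} → (Fin ⌊ n /2⌋ → Subset n) → Set
IsPairing B = (∀ i → ∣ B i ∣ ≡ 2) × (∀ i j → i ≢ j → B i ∩ B j ≡ ⊥)

_∈𝓑_ : ∀ {n} → Subset n → (Fin ⌊ n /2⌋ → Subset n) → Set
X ∈𝓑 B = ∃ λ S → X ≡ ⋃[ S ] B

SubfamilyTypeI : ∀ {m n} → (Fin m → Subset n) → Set
SubfamilyTypeI {m} {n} A =
  Σ (Fin ⌊ n /2⌋ → Subset n) λ B → IsPairing B × (∀ j → A j ∈𝓑 B)

SubfamilyTypeII : ∀ {m n} → ℕ → (Fin m → Subset n) → Set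
SubfamilyTypeII {m} {n} k A =
  ¬ (2 ∣ n) ×
  Σ (Fin ⌊ n /2⌋ → Subset n) λ B → IsPairing B ×
  Σ (Fin n) λ i → ((∀ l → i ∉ B l) × (∀ x → x ≢ i → ∃ λ l → x ∈ B l)) ×
  Σ (Fin (k ∸ 1) → Subset n) λ C → Injective _≡_ _≡_ C × (∀ l → C l ∈𝓑 B) ×
  (∀ j → A j ∈𝓑 B ⊎ ∃ λ l → A j ≡ C l ∪ ⁅ i ⁆)

{-# OPTIONS --safe #-}
module Submission where

-- Work in F₂ⁿ with the pairing x · y = |x ∩ y| mod 2. Greedily deleting maximal odd tuples of at most k − 1
-- sets costs at most (k − 1) n sets, because the deleted tuples give a triangular system. The rest L
-- has all intersections of at most three sets even, so its span is isotropic, and as |L| > 2^⌊n/2⌋ / 2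
-- the span is maximal isotropic and hence closed under ∩. The atoms of this Boolean ring are nonempty,
-- even and at least ⌊n/2⌋ in number, so they are ⌊n/2⌋ disjoint pairs. Since |L| exceeds ¾ of all unions
-- of pairs, each pair is an intersection of k − 1 members of L; therefore no set of the family
-- splits a pair, and only the point left over when n is odd remains to be discussed.

open import Defs
open import Data.Nat using (ℕ; zero; suc; _+_; _*_; _∸_; _^_; _<_; _≤_; ⌊_/2⌋; ⌈_/2⌉; z≤n; s≤s; _≤?_; >-nonZero)
open import Data.Nat.Properties
open import Data.Nat.Divisibility using (_∣_; divides; ∣m∣n⇒∣m+n; ∣m+n∣m⇒∣n; ∣-refl; _∣0; ∣⇒≤; m∣m*n)
open import Data.Nat.Induction using (<-rec)
open import Data.Nat.Logarithm using (⌈log₂_⌉; ⌈log₂⌉-mono-≤; ⌈log₂⌈n/2⌉⌉≡⌈log₂n⌉∸1)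
open import Data.Bool using (Bool; true; false; _xor_; _∧_; _∨_; not; if_then_else_)
import Data.Bool.Properties as Bool
open import Data.Fin using (Fin; zero; suc)
import Data.Fin.Properties as Fin
open import Data.Fin.Subset using (Subset; _∩_; _∪_; ⊥; ⊤; ⁅_⁆; ∣_∣; ∁; ⋂)
open import Data.Fin.Subset.Properties using (∣p∣≡n⇒p≡⊤; p⊂q⇒∣p∣<∣q∣; ∪-identityˡ; ∣p∣≤n; ∣⊤∣≡n; ∣⊥∣≡0; ∣∁p∣≡n∸∣p∣; ∣⁅x⁆∣≡1; x∈⁅y⁆⇒x≡y; x∈⁅x⁆)
open import Data.List as List using (List; []; _∷_; _++_; length; map; filter; take; reverse; tabulate; allFin)
open import Data.List.Properties using (length-take; length-tabulate; filter-notAll; length-++; length-map; unfold-reverse; length-reverse; map-++)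
import Data.List.Membership.DecPropositional as DecMembership
open import Data.List.Membership.Propositional using (_∈_; _∉_; find; lose)
open import Data.List.Membership.Propositional.Properties
open import Data.List.Relation.Binary.Disjoint.Propositional using (Disjoint)
open import Data.List.Relation.Binary.Subset.Propositional using (_⊆_)
open import Data.List.Relation.Unary.All as All using (All; []; _∷_)
import Data.List.Relation.Unary.All.Properties as All
open import Data.List.Relation.Unary.AllPairs as AllPairs using (AllPairs; []; _∷_)
import Data.List.Relation.Unary.AllPairs.Properties as AllPairs
open import Data.List.Relation.Unary.Any as Any using (Any; here; there; any?)
import Data.List.Relation.Unary.Any.Properties as Any
import Data.List.Relation.Unary.Unique.DecPropositional as DecUnique
open import Data.List.Relation.Unary.Unique.Propositional using (Unique)
import Data.List.Relation.Unary.Unique.Propositional.Properties as Unique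
open import Data.Product using (Σ; ∃; _×_; _,_; proj₁; proj₂; swap)
open import Data.Sum using (_⊎_; inj₁; inj₂; [_,_]′)
open import Data.Vec as Vec using (Vec; []; _∷_; lookup; zipWith; _[_]≔_; insertAt; removeAt)
open import Data.Vec.Properties using (lookup-zipWith; zipWith-assoc; zipWith-comm; zipWith-idem;
  zipWith-identityˡ; zipWith-identityʳ; zipWith-zeroˡ;
  zipWith-distribʳ; lookup-replicate; ≡-dec;
  lookup∘update′; insertAt-removeAt; tabulate∘lookup; tabulate-cong; lookup∘tabulate; lookup-map; []=⇒lookup; lookup⇒[]=)
open import Function using (_∘_; id)
open import Function.Definitions using (Injective)
open import Relation.Binary.PropositionalEquality
open import Relation.Nullary using (does; _×-dec_; ¬?; ¬_; Dec; yes; no; contradiction)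
open import Relation.Unary using (Decidable)

-- The hypothesis controls only intersections of exactly k sets; smaller ones may be odd, which is
-- why something must be deleted before any linear algebra applies. The deleted sets still belong to
-- the family and must be classified too, but nothing is known about them beyond the hypothesis
-- itself. So locating L inside a family of unions of pairs is not enough: a pair must be written as
-- an intersection of exactly k - 1 members of L, since only then does adding an arbitrary further
-- set give a k-wise intersection.
--
-- This explains both constants. Half of the 2^⌊n/2⌋ unions avoid a given pair, so a family with
-- more than ¾ of all unions has more than half of those that contain the pair, and pairing each of
-- these with its complement outside the pair puts both partners in L for some choice. Two sets
-- already cut out the pair; the lower bound on n ensures that L has enough sets through it to bring
-- their number up to k - 1.
--
-- Dimension is handled by counting: spans are explicit lists, and each basis vector carries a dual
-- vector that certifies independence.

private variable
  k m n : ℕ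
  X : Set

-- Counting with duplicate-free lists

unique⇒length≤ : {xs ys : List X} → Unique xs → xs ⊆ ys → length xs ≤ length ys
unique⇒length≤ {xs = []} _ _ = z≤n
unique⇒length≤ {xs = x ∷ xs} (x∉xs ∷ u) xs⊆ys with ∈-∃++ (xs⊆ys (here refl))
... | as , bs , refl = begin
  suc (length xs)              ≤⟨ s≤s (unique⇒length≤ u xs⊆as++bs) ⟩
  suc (length (as ++ bs))      ≡⟨ cong suc (length-++ as) ⟩
  suc (length as + length bs)  ≡⟨ +-suc (length as) (length bs) ⟨
  length as + suc (length bs)  ≡⟨ length-++ as ⟨
  length (as ++ x ∷ bs)        ∎
  where
  open ≤-Reasoning
  xs⊆as++bs : xs ⊆ as ++ bs
  xs⊆as++bs z∈xs with ∈-++⁻ as (xs⊆ys (there z∈xs))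
  ... | inj₁ z∈as         = ∈-++⁺ˡ z∈as
  ... | inj₂ (here refl)  = contradiction refl (All.lookup x∉xs z∈xs)
  ... | inj₂ (there z∈bs) = ∈-++⁺ʳ as z∈bs

AllPairs-reverse : {R : X → X → Set} {xs : List X} → AllPairs (λ x y → R y x) xs → AllPairs R (reverse xs)
AllPairs-reverse [] = []
AllPairs-reverse {R = R} {x ∷ xs} (px ∷ pxs) = subst (AllPairs R) (sym (unfold-reverse x xs))
  (AllPairs.++⁺ (AllPairs-reverse pxs) ([] ∷ [])
    (All.tabulate λ y∈ → All.lookup px (Any.reverse⁻ y∈) ∷ []))

-- Subsets as vectors over F₂ with the parity pairing

_≟ˢ_ : (x y : Subset n) → Dec (x ≡ y)
_≟ˢ_ = ≡-dec Bool._≟_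


_∈?_ : (x : Subset n) (L : List (Subset n)) → Dec (x ∈ L)
_∈?_ = DecMembership._∈?_ _≟ˢ_

infixl 6 _⊕_
_⊕_ : Subset n → Subset n → Subset n
_⊕_ = zipWith _xor_

⊕-assoc : (x y z : Subset n) → (x ⊕ y) ⊕ z ≡ x ⊕ (y ⊕ z)
⊕-assoc = zipWith-assoc Bool.xor-assoc

⊕-comm : (x y : Subset n) → x ⊕ y ≡ y ⊕ x
⊕-comm = zipWith-comm Bool.xor-comm

⊕-identityˡ : (x : Subset n) → ⊥ ⊕ x ≡ x
⊕-identityˡ = zipWith-identityˡ Bool.xor-identityˡ

⊕-identityʳ : (x : Subset n) → x ⊕ ⊥ ≡ x
⊕-identityʳ = zipWith-identityʳ Bool.xor-identityʳ

⊕-self : (x : Subset n) → x ⊕ x ≡ ⊥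
⊕-self []      = refl
⊕-self (b ∷ x) = cong₂ _∷_ (Bool.xor-same b) (⊕-self x)

⊕-cancelʳ : (x y : Subset n) → (x ⊕ y) ⊕ y ≡ x
⊕-cancelʳ x y = trans (⊕-assoc x y y) (trans (cong (x ⊕_) (⊕-self y)) (⊕-identityʳ x))

⊕-cancelˡ : (x y : Subset n) → x ⊕ (x ⊕ y) ≡ y
⊕-cancelˡ x y = trans (⊕-comm x (x ⊕ y)) (trans (cong (_⊕ x) (⊕-comm x y)) (⊕-cancelʳ y x))

⊕-injectiveʳ : (x : Subset n) {y z : Subset n} → x ⊕ y ≡ x ⊕ z → y ≡ z
⊕-injectiveʳ x {y} {z} eq = trans (sym (⊕-cancelˡ x y)) (trans (cong (x ⊕_) eq) (⊕-cancelˡ x z))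

∩-comm : (x y : Subset n) → x ∩ y ≡ y ∩ x
∩-comm = zipWith-comm Bool.∧-comm

∩-assoc : (x y z : Subset n) → (x ∩ y) ∩ z ≡ x ∩ (y ∩ z)
∩-assoc = zipWith-assoc Bool.∧-assoc

∩-idem : (x : Subset n) → x ∩ x ≡ x
∩-idem = zipWith-idem Bool.∧-idem

∩-distribʳ-⊕ : (z x y : Subset n) → (x ⊕ y) ∩ z ≡ (x ∩ z) ⊕ (y ∩ z)
∩-distribʳ-⊕ = zipWith-distribʳ Bool.∧-distribʳ-xor

∩-zeroˡ : (x : Subset n) → ⊥ ∩ x ≡ ⊥
∩-zeroˡ = zipWith-zeroˡ Bool.∧-zeroˡ

parity : Subset n → Bool
parity []      = false
parity (b ∷ x) = b xor parity x

xor-interchange : ∀ a b c d → (a xor b) xor (c xor d) ≡ (a xor c) xor (b xor d)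
xor-interchange false b c d = trans (sym (Bool.xor-assoc b c d))
  (trans (cong (_xor d) (Bool.xor-comm b c)) (Bool.xor-assoc c b d))
xor-interchange true false false d = refl
xor-interchange true false true  d = Bool.not-involutive d
xor-interchange true true  false d = sym (Bool.not-involutive d)
xor-interchange true true  true  d = refl

parity-⊕ : (x y : Subset n) → parity (x ⊕ y) ≡ parity x xor parity y
parity-⊕ []      []      = refl
parity-⊕ (a ∷ x) (b ∷ y) = trans (cong ((a xor b) xor_) (parity-⊕ x y))
  (xor-interchange a b (parity x) (parity y))

parity-⊥ : ∀ n → parity (⊥ {n}) ≡ false
parity-⊥ zero    = refl
parity-⊥ (suc n) = parity-⊥ n

infix 7 _·_
_·_ : Subset n → Subset n → Bool
x · y = parity (x ∩ y)

·-comm : (x y : Subset n) → x · y ≡ y · x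
·-comm x y = cong parity (∩-comm x y)

·-⊕ˡ : (x y z : Subset n) → (x ⊕ y) · z ≡ x · z xor y · z
·-⊕ˡ x y z = trans (cong parity (∩-distribʳ-⊕ z x y)) (parity-⊕ (x ∩ z) (y ∩ z))

·-⊕ʳ : (z x y : Subset n) → z · (x ⊕ y) ≡ z · x xor z · y
·-⊕ʳ z x y = trans (·-comm z (x ⊕ y)) (trans (·-⊕ˡ x y z) (cong₂ _xor_ (·-comm x z) (·-comm y z)))

·-zeroˡ : (x : Subset n) → ⊥ · x ≡ false
·-zeroˡ {n} x = trans (cong parity (∩-zeroˡ x)) (parity-⊥ n)

·-zeroʳ : (x : Subset n) → x · ⊥ ≡ false
·-zeroʳ x = trans (·-comm x ⊥) (·-zeroˡ x)

-- Singletons are the coordinate functionals of the pairing; `extend` uses one of them as the dual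
-- of a new basis vector.
⁅⁆-· : (p : Fin n) (x : Subset n) → ⁅ p ⁆ · x ≡ lookup x p
⁅⁆-· zero    (b ∷ x) = trans (cong (b xor_) (·-zeroˡ x)) (Bool.xor-identityʳ b)
⁅⁆-· (suc p) (b ∷ x) = ⁅⁆-· p x

≢⊥⇒nonempty : (x : Subset n) → x ≢ ⊥ → ∃ λ p → lookup x p ≡ true
≢⊥⇒nonempty []          x≢⊥ = contradiction refl x≢⊥
≢⊥⇒nonempty (true ∷ x)  x≢⊥ = zero , refl
≢⊥⇒nonempty (false ∷ x) x≢⊥ with ≢⊥⇒nonempty x (x≢⊥ ∘ cong (false ∷_))
... | p , p∈x = suc p , p∈x

-- Enumerated power sets and spans

subsets : ∀ n → List (Subset n)
subsets zero    = [] ∷ []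
subsets (suc n) = map (true ∷_) (subsets n) ++ map (false ∷_) (subsets n)

length-subsets : ∀ n → length (subsets n) ≡ 2 ^ n
length-subsets zero    = refl
length-subsets (suc n) = begin
  length (map (true ∷_) (subsets n) ++ map (false ∷_) (subsets n))
    ≡⟨ length-++ (map (true ∷_) (subsets n)) ⟩
  length (map (true ∷_) (subsets n)) + length (map (false ∷_) (subsets n))
    ≡⟨ cong₂ _+_ (length-map _ (subsets n)) (length-map _ (subsets n)) ⟩
  length (subsets n) + length (subsets n)
    ≡⟨ cong (λ l → l + l) (length-subsets n) ⟩
  2 ^ n + 2 ^ n
    ≡⟨ cong (2 ^ n +_) (+-identityʳ (2 ^ n)) ⟨
  2 ^ suc n ∎
  where open ≡-Reasoning

∈-subsets : (x : Subset n) → x ∈ subsets n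
∈-subsets []                  = here refl
∈-subsets (true ∷ x)          = ∈-++⁺ˡ (∈-map⁺ _ (∈-subsets x))
∈-subsets {suc n} (false ∷ x) = ∈-++⁺ʳ (map (true ∷_) (subsets n)) (∈-map⁺ _ (∈-subsets x))

2^-cancel-≤ : ∀ {a b} → 2 ^ a ≤ 2 ^ b → a ≤ b
2^-cancel-≤ {a} {b} le with a ≤? b
... | yes a≤b = a≤b
... | no  a≰b = contradiction le (<⇒≱ (^-monoʳ-< 2 (s≤s (s≤s z≤n)) (≰⇒> a≰b)))

2^-cancel-< : ∀ {a b} → 2 ^ a < 2 ^ b → a < b
2^-cancel-< {a} {b} lt with suc a ≤? b
... | yes a<b = a<b
... | no  a≮b = contradiction lt (≤⇒≯ (^-monoʳ-≤ 2 (≮⇒≥ a≮b)))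

-- All 2^r subset sums are listed, with repetitions if the r vectors are dependent. Hence the length
-- is always a power of two, and independence becomes absence of duplicates.
span : List (Subset n) → List (Subset n)
span []       = ⊥ ∷ []
span (v ∷ vs) = span vs ++ map (v ⊕_) (span vs)

length-span : (vs : List (Subset n)) → length (span vs) ≡ 2 ^ length vs
length-span []       = refl
length-span (v ∷ vs) = begin
  length (span vs ++ map (v ⊕_) (span vs))        ≡⟨ length-++ (span vs) ⟩
  length (span vs) + length (map (v ⊕_) (span vs)) ≡⟨ cong (length (span vs) +_) (length-map _ (span vs)) ⟩
  length (span vs) + length (span vs)             ≡⟨ cong (λ l → l + l) (length-span vs) ⟩
  2 ^ length vs + 2 ^ length vs                   ≡⟨ cong (2 ^ length vs +_) (+-identityʳ _) ⟨
  2 ^ suc (length vs)                             ∎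
  where open ≡-Reasoning

⊥∈span : (vs : List (Subset n)) → ⊥ ∈ span vs
⊥∈span []       = here refl
⊥∈span (v ∷ vs) = ∈-++⁺ˡ (⊥∈span vs)

∈-span-∷⁺ : (v : Subset n) (vs : List (Subset n)) {x : Subset n} → x ∈ span vs → v ⊕ x ∈ span (v ∷ vs)
∈-span-∷⁺ v vs x∈ = ∈-++⁺ʳ (span vs) (∈-map⁺ (v ⊕_) x∈)

∈-span-∷⁻ : (v : Subset n) (vs : List (Subset n)) {x : Subset n} → x ∈ span (v ∷ vs) →
  x ∈ span vs ⊎ ∃ λ y → y ∈ span vs × x ≡ v ⊕ y
∈-span-∷⁻ v vs x∈ with ∈-++⁻ (span vs) x∈
... | inj₁ x∈vs = inj₁ x∈vs
... | inj₂ x∈v  = inj₂ (∈-map⁻ (v ⊕_) x∈v)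

⊆-span : (vs : List (Subset n)) → vs ⊆ span vs
⊆-span (v ∷ vs) (here refl) = subst (_∈ span (v ∷ vs)) (⊕-identityʳ v) (∈-span-∷⁺ v vs (⊥∈span vs))
⊆-span (v ∷ vs) (there x∈)  = ∈-++⁺ˡ (⊆-span vs x∈)

span-⊕ : (vs : List (Subset n)) {x y : Subset n} → x ∈ span vs → y ∈ span vs → x ⊕ y ∈ span vs
span-⊕ [] (here refl) (here refl) = here (⊕-self ⊥)
span-⊕ (v ∷ vs) {x} {y} x∈ y∈ with ∈-span-∷⁻ v vs x∈ | ∈-span-∷⁻ v vs y∈
... | inj₁ x∈′ | inj₁ y∈′ = ∈-++⁺ˡ (span-⊕ vs x∈′ y∈′)
... | inj₂ (x′ , x∈′ , refl) | inj₁ y∈′ =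
  subst (_∈ span (v ∷ vs)) (sym (⊕-assoc v x′ y)) (∈-span-∷⁺ v vs (span-⊕ vs x∈′ y∈′))
... | inj₁ x∈′ | inj₂ (y′ , y∈′ , refl) =
  subst (_∈ span (v ∷ vs)) (sym (trans (⊕-comm x (v ⊕ y′)) (trans (⊕-assoc v y′ x) (cong (v ⊕_) (⊕-comm y′ x)))))
    (∈-span-∷⁺ v vs (span-⊕ vs x∈′ y∈′))
... | inj₂ (x′ , x∈′ , refl) | inj₂ (y′ , y∈′ , refl) =
  subst (_∈ span (v ∷ vs)) eq (∈-++⁺ˡ (span-⊕ vs x∈′ y∈′))
  where
  eq : x′ ⊕ y′ ≡ (v ⊕ x′) ⊕ (v ⊕ y′)
  eq = begin
    x′ ⊕ y′               ≡⟨ cong (x′ ⊕_) (⊕-cancelˡ v y′) ⟨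
    x′ ⊕ (v ⊕ (v ⊕ y′))   ≡⟨ ⊕-assoc x′ v (v ⊕ y′) ⟨
    (x′ ⊕ v) ⊕ (v ⊕ y′)   ≡⟨ cong (_⊕ (v ⊕ y′)) (⊕-comm x′ v) ⟩
    (v ⊕ x′) ⊕ (v ⊕ y′)   ∎
    where open ≡-Reasoning

span-elim : (P : Subset n → Set) → P ⊥ → (∀ {x y} → P x → P y → P (x ⊕ y)) →
  (vs : List (Subset n)) → (∀ {v} → v ∈ vs → P v) → ∀ {x} → x ∈ span vs → P x
span-elim P P⊥ P⊕ []       Pvs (here refl) = P⊥
span-elim P P⊥ P⊕ (v ∷ vs) Pvs x∈ with ∈-span-∷⁻ v vs x∈
... | inj₁ x∈′              = span-elim P P⊥ P⊕ vs (Pvs ∘ there) x∈′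
... | inj₂ (y , y∈ , refl) = P⊕ (Pvs (here refl)) (span-elim P P⊥ P⊕ vs (Pvs ∘ there) y∈)

span-⊆ : (vs us : List (Subset n)) → vs ⊆ span us → span vs ⊆ span us
span-⊆ vs us = span-elim (_∈ span us) (⊥∈span us) (span-⊕ us) vs

span-· : (w : Subset n) (vs : List (Subset n)) → (∀ {v} → v ∈ vs → w · v ≡ false) →
  ∀ {x} → x ∈ span vs → w · x ≡ false
span-· w = span-elim (λ x → w · x ≡ false) (·-zeroʳ w)
  λ {x} {y} wx wy → trans (·-⊕ʳ w x y) (cong₂ _xor_ wx wy)

-- Triangular systems and bounds on dimension

Triangular : List (Subset n × Subset n) → Set
Triangular s = All (λ a → proj₁ a · proj₂ a ≡ true) s × AllPairs (λ a b → proj₁ a · proj₂ b ≡ false) s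

vectors : List (Subset n × Subset n) → List (Subset n)
vectors = map proj₂

vectors-· : (w : Subset n) {s : List (Subset n × Subset n)} → All (λ b → w · proj₂ b ≡ false) s →
  ∀ {x} → x ∈ span (vectors s) → w · x ≡ false
vectors-· w {s} ws = span-· w (vectors s) λ v∈ → All.lookup (All.map⁺ ws) v∈

-- The matrix of products `w · v` has ones on the diagonal and zeros above it, so the leading `w`
-- vanishes on the span of the later vectors and equals one on its translate by `v`. The two halves
-- of the span are therefore disjoint.
triangular⇒unique-span : {s : List (Subset n × Subset n)} → Triangular s → Unique (span (vectors s))
triangular⇒unique-span {s = []} _ = [] ∷ []
triangular⇒unique-span {s = (w , v) ∷ s} (wv ∷ d , ws ∷ t) =
  Unique.++⁺ u (Unique.map⁺ (⊕-injectiveʳ v) u) disj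
  where
  u = triangular⇒unique-span (d , t)
  disj : Disjoint (span (vectors s)) (map (v ⊕_) (span (vectors s)))
  disj (x∈ , x∈v) with ∈-map⁻ (v ⊕_) x∈v
  ... | y , y∈ , refl = contradiction
    (trans (sym (vectors-· w ws x∈)) (trans (·-⊕ʳ w v y) (cong₂ _xor_ wv (vectors-· w ws y∈)))) λ ()

triangular⇒length≤ : {s : List (Subset n × Subset n)} → Triangular s → length s ≤ n
triangular⇒length≤ {n} {s} t = 2^-cancel-≤ (begin
  2 ^ length s                 ≡⟨ cong (2 ^_) (length-map proj₂ s) ⟨
  2 ^ length (vectors s)       ≡⟨ length-span (vectors s) ⟨
  length (span (vectors s))    ≤⟨ unique⇒length≤ (triangular⇒unique-span t) (λ {x} _ → ∈-subsets x) ⟩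
  length (subsets n)           ≡⟨ length-subsets n ⟩
  2 ^ n                        ∎)
  where open ≤-Reasoning

-- If the v's are moreover isotropic, listing the pairs (v , w) backwards and then the pairs
-- (w , v) forwards is again triangular.
isotropic⇒length≤ : {s : List (Subset n × Subset n)} → Triangular s →
  (∀ {x y} → x ∈ vectors s → y ∈ vectors s → x · y ≡ false) → 2 * length s ≤ n
isotropic⇒length≤ {n} {s} (d , t) iso = subst (_≤ n) len (triangular⇒length≤ (diag , above))
  where
  s′ = reverse (map swap s) ++ s
  len : length s′ ≡ 2 * length s
  len = trans (length-++ (reverse (map swap s)))
    (cong₂ _+_ (trans (length-reverse (map swap s)) (length-map swap s)) (sym (+-identityʳ _)))
  ∈-back : ∀ {a} → a ∈ reverse (map swap s) → ∃ λ b → b ∈ s × a ≡ swap b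
  ∈-back a∈ = ∈-map⁻ swap (Any.reverse⁻ a∈)
  diag : All (λ a → proj₁ a · proj₂ a ≡ true) s′
  diag = All.++⁺ (All.tabulate back) d
    where
    back : ∀ {a} → a ∈ reverse (map swap s) → proj₁ a · proj₂ a ≡ true
    back a∈ with ∈-back a∈
    ... | (w , v) , b∈ , refl = trans (·-comm v w) (All.lookup d b∈)
  above : AllPairs (λ a b → proj₁ a · proj₂ b ≡ false) s′
  above = AllPairs.++⁺
    (AllPairs-reverse (AllPairs.map⁺ (AllPairs.map (λ {a} {b} e → trans (·-comm (proj₂ b) (proj₁ a)) e) t)))
    t
    (All.tabulate λ {a} a∈ → All.tabulate λ {b} b∈ → cross a∈ b∈)
    where
    cross : ∀ {a b} → a ∈ reverse (map swap s) → b ∈ s → proj₁ a · proj₂ b ≡ false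
    cross a∈ b∈ with ∈-back a∈
    ... | c , c∈ , refl = iso (∈-map⁺ proj₂ c∈) (∈-map⁺ proj₂ b∈)

-- Gaussian elimination from front to back: `v` is added when its `w` sees the current vector. Later
-- corrections come from later vectors, on which `w` vanishes, so they do not undo this.
reduce : {s : List (Subset n × Subset n)} → Triangular s → (x : Subset n) →
  ∃ λ y → y ∈ span (vectors s) × All (λ a → proj₁ a · (x ⊕ y) ≡ false) s
reduce {s = []} _ x = ⊥ , here refl , []
reduce {s = (w , v) ∷ s} (wv ∷ d , ws ∷ t) x with w · x in wx
... | false with reduce (d , t) x
...   | y , y∈ , o = y , ∈-++⁺ˡ y∈ , trans (·-⊕ʳ w x y) (cong₂ _xor_ wx (vectors-· w ws y∈)) ∷ o
reduce {s = (w , v) ∷ s} (wv ∷ d , ws ∷ t) x | true with reduce (d , t) (x ⊕ v)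
...   | y , y∈ , o = v ⊕ y , ∈-span-∷⁺ v (vectors s) y∈ , o₁ ∷
        All.map (λ {a} → trans (cong (proj₁ a ·_) (sym (⊕-assoc x v y)))) o
  where
  o₁ : w · (x ⊕ (v ⊕ y)) ≡ false
  o₁ = trans (·-⊕ʳ w x (v ⊕ y))
    (cong₂ _xor_ wx (trans (·-⊕ʳ w v y) (cong₂ _xor_ wv (vectors-· w ws y∈))))

-- The reduced vector `x ⊕ y` is orthogonal to every old `w` and is nonzero because `x` is outside
-- the span; any point of it gives a dual singleton. The new pair goes to the end of the list, so
-- the products of the new `w` with the old vectors do not matter.
extend : {s : List (Subset n × Subset n)} → Triangular s → {x : Subset n} → x ∉ span (vectors s) →
  ∃ λ w → ∃ λ y → y ∈ span (vectors s) × Triangular (s ++ (w , x ⊕ y) ∷ [])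
extend {s = s} (d , t) {x} x∉ with reduce (d , t) x
... | y , y∈ , o with ≢⊥⇒nonempty (x ⊕ y) (λ eq → x∉ (subst (_∈ span (vectors s))
        (trans (sym (trans (cong (_⊕ y) eq) (⊕-identityˡ y))) (⊕-cancelʳ x y)) y∈))
...   | p , eq = ⁅ p ⁆ , y , y∈ ,
        All.++⁺ d (trans (⁅⁆-· p (x ⊕ y)) eq ∷ []) ,
        AllPairs.++⁺ t ([] ∷ []) (All.map (_∷ []) o)

-- Reduction takes the basis vectors out of `L` itself, so only inclusion in `span L` is claimed.
-- That suffices for the basis to inherit isotropy and trilinearity.
basis : (L : List (Subset n)) →
  ∃ λ s → Triangular s × vectors s ⊆ span L × L ⊆ span (vectors s)
basis [] = [] , ([] , []) , (λ ()) , λ ()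
basis (x ∷ L) with basis L
... | s , t , vs⊆ , L⊆ with x ∈? span (vectors s)
...   | yes x∈ = s , t , ∈-++⁺ˡ ∘ vs⊆ , λ { (here refl) → x∈ ; (there y∈) → L⊆ y∈ }
...   | no x∉ with extend t x∉
...     | w , y , y∈ , t′ = s ++ (w , x ⊕ y) ∷ [] , t′ ,
  subst (_⊆ span (x ∷ L)) (sym vs′) below , subst (λ vs → x ∷ L ⊆ span vs) (sym vs′) above
  where
  vs′ : vectors (s ++ (w , x ⊕ y) ∷ []) ≡ vectors s ++ (x ⊕ y) ∷ []
  vs′ = map-++ proj₂ s ((w , x ⊕ y) ∷ [])
  below : vectors s ++ (x ⊕ y) ∷ [] ⊆ span (x ∷ L)
  below z∈ with ∈-++⁻ (vectors s) z∈
  ... | inj₁ z∈s         = ∈-++⁺ˡ (vs⊆ z∈s)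
  ... | inj₂ (here refl) = ∈-span-∷⁺ x L (span-⊆ (vectors s) L vs⊆ y∈)
  us = vectors s ++ (x ⊕ y) ∷ []
  old : span (vectors s) ⊆ span us
  old = span-⊆ (vectors s) us (⊆-span us ∘ ∈-++⁺ˡ)
  above : x ∷ L ⊆ span us
  above (here refl) = subst (_∈ span us) (⊕-cancelʳ x y)
    (span-⊕ us (⊆-span us (∈-++⁺ʳ (vectors s) (here refl))) (old y∈))
  above (there z∈)  = old (L⊆ z∈)

-- Isotropic and trilinear spans

Isotropic : List (Subset n) → Set
Isotropic L = ∀ {x y} → x ∈ L → y ∈ L → x · y ≡ false

span-isotropic : (L : List (Subset n)) → Isotropic L → Isotropic (span L)
span-isotropic L iso {x} x∈ = span-· x L λ {v} v∈ → trans (·-comm x v) (span-· v L (iso v∈) x∈)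

-- The form is the parity of a triple intersection. Arguments may coincide, so single sets and
-- pairwise intersections are covered as well.
Trilinear : List (Subset n) → Set
Trilinear L = ∀ {x y z} → x ∈ L → y ∈ L → z ∈ L → (x ∩ y) · z ≡ false

∩-·-rotate : (x y z : Subset n) → (x ∩ y) · z ≡ (z ∩ x) · y
∩-·-rotate x y z = cong parity (trans (∩-comm (x ∩ y) z) (sym (∩-assoc z x y)))

-- `span-·` extends linearly in the last argument only; cyclic symmetry of the form brings each
-- argument there in turn.
span-trilinear : (L : List (Subset n)) → Trilinear L → Trilinear (span L)
span-trilinear L tri {x} {y} x∈ y∈ =
  span-· (x ∩ y) L λ {v} v∈ → trans (∩-·-rotate x y v)
    (span-· (v ∩ x) L (λ {u} u∈ → trans (∩-·-rotate v x u)
      (span-· (u ∩ v) L (tri u∈ v∈) x∈)) y∈)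

2*⌊n/2⌋≤n : ∀ n → 2 * ⌊ n /2⌋ ≤ n
2*⌊n/2⌋≤n zero          = z≤n
2*⌊n/2⌋≤n (suc zero)    = z≤n
2*⌊n/2⌋≤n (suc (suc n)) = subst (_≤ suc (suc n)) (sym (*-suc 2 ⌊ n /2⌋)) (s≤s (s≤s (2*⌊n/2⌋≤n n)))

n<2*[1+⌊n/2⌋] : ∀ n → n < 2 * suc ⌊ n /2⌋
n<2*[1+⌊n/2⌋] zero          = s≤s z≤n
n<2*[1+⌊n/2⌋] (suc zero)    = s≤s (s≤s z≤n)
n<2*[1+⌊n/2⌋] (suc (suc n)) =
  subst (suc (suc n) <_) (sym (*-suc 2 (suc ⌊ n /2⌋))) (s≤s (s≤s (n<2*[1+⌊n/2⌋] n)))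

-- Otherwise `z` could be adjoined, giving an isotropic triangular system with more than ⌊n/2⌋
-- vectors. Orthogonality of `z` to itself is a separate requirement, since `z · z` is the parity of
-- `z` and may be odd.
isotropic-maximal : {s : List (Subset n × Subset n)} → Triangular s → Isotropic (vectors s) →
  ⌊ n /2⌋ ≤ length s → {z : Subset n} → z · z ≡ false → (∀ {v} → v ∈ vectors s → z · v ≡ false) →
  z ∈ span (vectors s)
isotropic-maximal {n} {s} t iso big {z} zz zv with z ∈? span (vectors s)
... | yes z∈ = z∈
... | no z∉ with extend t z∉
...   | w , y , y∈ , t′ = contradiction (begin-strict
  n                                        <⟨ n<2*[1+⌊n/2⌋] n ⟩
  2 * suc ⌊ n /2⌋                          ≤⟨ *-monoʳ-≤ 2 (s≤s big) ⟩
  2 * suc (length s)                       ≡⟨ cong (2 *_) (trans (length-++ s) (+-comm (length s) 1)) ⟨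
  2 * length (s ++ (w , z ⊕ y) ∷ [])       ≤⟨ isotropic⇒length≤ t′ (λ a b → iso′ (vs′⊆ a) (vs′⊆ b)) ⟩
  n                                        ∎) (<-irrefl refl)
  where
  open ≤-Reasoning
  us = z ∷ vectors s
  iso′ : Isotropic (span us)
  iso′ = span-isotropic us λ where
    (here refl) (here refl)     → zz
    (here refl) (there b)       → zv b
    {x} (there a)   (here refl) → trans (·-comm x z) (zv a)
    (there a)   (there b)       → iso a b
  vs′⊆ : vectors (s ++ (w , z ⊕ y) ∷ []) ⊆ span us
  vs′⊆ x∈ with ∈-++⁻ (vectors s) (subst (_ ∈_) (map-++ proj₂ s _) x∈)
  ... | inj₁ x∈s         = ⊆-span us (there x∈s)
  ... | inj₂ (here refl) = ∈-span-∷⁺ z (vectors s) y∈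

-- Even Boolean rings and their atoms

record IsEvenRing (R : List (Subset n)) : Set where
  field
    ⊕-closed : ∀ {x y} → x ∈ R → y ∈ R → x ⊕ y ∈ R
    ∩-closed : ∀ {x y} → x ∈ R → y ∈ R → x ∩ y ∈ R
    even     : ∀ {x} → x ∈ R → parity x ≡ false

-- Trilinearity makes x ∩ y orthogonal to the span, and the span is too large to have a proper
-- isotropic extension.
trilinear⇒evenRing : {L : List (Subset n)} → Unique L → Trilinear L → 2 ^ ⌊ n /2⌋ < 2 * length L →
  ∃ λ R → IsEvenRing R × L ⊆ R
trilinear⇒evenRing {n} {L} u tri big with basis L
... | s , t , vs⊆ , L⊆ = span (vectors s) , record
  { ⊕-closed = span-⊕ (vectors s)
  ; ∩-closed = λ {x} {y} x∈ y∈ → isotropic-maximal t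
      (λ a b → iso (⊆-span _ a) (⊆-span _ b)) large
      (trans (cong parity (trans (∩-idem (x ∩ y)) (sym ([x∩y]∩y≡x∩y x y)))) (tri′ x∈ y∈ y∈))
      (λ v∈ → tri′ x∈ y∈ (⊆-span _ v∈))
  ; even = λ {x} x∈ → trans (cong parity (sym (∩-idem x))) (iso x∈ x∈)
  } , L⊆
  where
  open ≤-Reasoning
  [x∩y]∩y≡x∩y : (x y : Subset n) → (x ∩ y) ∩ y ≡ x ∩ y
  [x∩y]∩y≡x∩y x y = trans (∩-assoc x y y) (cong (x ∩_) (∩-idem y))
  R⊆ : span (vectors s) ⊆ span L
  R⊆ = span-⊆ (vectors s) L vs⊆
  tri′ : Trilinear (span (vectors s))
  tri′ a b c = span-trilinear L tri (R⊆ a) (R⊆ b) (R⊆ c)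
  iso : Isotropic (span (vectors s))
  iso {x} a b = trans (cong (_· _) (sym (∩-idem x))) (tri′ a a b)
  large : ⌊ n /2⌋ ≤ length s
  -- The size of the span is a power of two, so exceeding half of 2^⌊n/2⌋ already forces it up to
  -- 2^⌊n/2⌋.
  large = ≤-pred (2^-cancel-< (begin-strict
    2 ^ ⌊ n /2⌋                    <⟨ big ⟩
    2 * length L                   ≤⟨ *-monoʳ-≤ 2 (unique⇒length≤ u L⊆) ⟩
    2 * length (span (vectors s))  ≡⟨ cong (2 *_) (length-span (vectors s)) ⟩
    2 * 2 ^ length (vectors s)     ≡⟨ cong (λ l → 2 * 2 ^ l) (length-map proj₂ s) ⟩
    2 ^ suc (length s)             ∎))

∧-true⁻ : ∀ {a b} → a ∧ b ≡ true → a ≡ true × b ≡ true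
∧-true⁻ {true} b = refl , b

lookup-∩⁺ : (x y : Subset n) (p : Fin n) → lookup x p ≡ true → lookup y p ≡ true → lookup (x ∩ y) p ≡ true
lookup-∩⁺ x y p a b = trans (lookup-zipWith _∧_ p x y) (cong₂ _∧_ a b)

lookup-∩⁻ : (x y : Subset n) (p : Fin n) → lookup (x ∩ y) p ≡ true → lookup x p ≡ true × lookup y p ≡ true
lookup-∩⁻ x y p e = ∧-true⁻ (trans (sym (lookup-zipWith _∧_ p x y)) e)

lookup-⊕ : (x y : Subset n) (p : Fin n) → lookup (x ⊕ y) p ≡ lookup x p xor lookup y p
lookup-⊕ x y p = lookup-zipWith _xor_ p x y

xor-∧-true⁻ : ∀ {a b} → a xor (a ∧ b) ≡ true → a ≡ true × b ≡ false
xor-∧-true⁻ {true} {false} _ = refl , refl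

≢true⇒≡false : ∀ {b} → b ≢ true → b ≡ false
≢true⇒≡false {false} _ = refl
≢true⇒≡false {true}  f = contradiction refl f

record IsAtom (R : List (Subset n)) (B : Subset n) : Set where
  field
    member   : B ∈ R
    nonempty : ∃ λ p → lookup B p ≡ true
    constant : ∀ {p q} → lookup B p ≡ true → lookup B q ≡ true → ∀ {y} → y ∈ R → lookup y p ≡ lookup y q

module _ {R : List (Subset n)} (ring : IsEvenRing R) where
  open IsEvenRing ring

  -- A member through `p` is cut down by each `y` in turn, to the part inside `y` or the part
  -- outside, whichever contains `p`. The outside part is `a ⊕ (a ∩ y)`, a complement relative to
  -- `a`: for odd n the full set is odd and cannot lie in the ring. Taking all of `R` for `ys` gives
  -- the atom at `p`.
  separate : ∀ {p x} → x ∈ R → lookup x p ≡ true → ∀ ys → ys ⊆ R →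
    ∃ λ a → a ∈ R × lookup a p ≡ true ×
      (∀ {q} → lookup a q ≡ true → ∀ {y} → y ∈ ys → lookup y q ≡ lookup y p)
  separate {x = x} x∈ xp [] _ = x , x∈ , xp , λ _ ()
  separate {p} x∈ xp (y ∷ ys) ys⊆ with separate x∈ xp ys (ys⊆ ∘ there) | lookup y p in yp
  ... | a , a∈ , ap , const | true = a ∩ y , ∩-closed a∈ (ys⊆ (here refl)) , lookup-∩⁺ a y p ap yp , λ
    { {q} e (here refl) → trans (proj₂ (lookup-∩⁻ a y q e)) (sym yp)
    ; {q} e (there z∈)  → const (proj₁ (lookup-∩⁻ a y q e)) z∈
    }
  ... | a , a∈ , ap , const | false =
    a ⊕ (a ∩ y) , ⊕-closed a∈ (∩-closed a∈ (ys⊆ (here refl))) ,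
    trans (lookup-diff p) (cong₂ (λ b c → b xor (b ∧ c)) ap yp) , λ
      { {q} e (here refl) → trans (proj₂ (xor-∧-true⁻ {lookup a q} (trans (sym (lookup-diff q)) e))) (sym yp)
      ; {q} e (there z∈)  → const (proj₁ (xor-∧-true⁻ {lookup a q} (trans (sym (lookup-diff q)) e))) z∈
      }
    where
    lookup-diff : ∀ q → lookup (a ⊕ (a ∩ y)) q ≡ lookup a q xor (lookup a q ∧ lookup y q)
    lookup-diff q = trans (lookup-⊕ a (a ∩ y) q) (cong (lookup a q xor_) (lookup-zipWith _∧_ q a y))

  -- An atom is added only for a point that no listed atom contains, so it differs from all of them.
  -- Points outside every member of `R` get none.
  atoms : (ps : List (Fin n)) → ∃ λ Bs → Unique Bs × All (IsAtom R) Bs ×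
    (∀ {p} → p ∈ ps → ∀ {y} → y ∈ R → lookup y p ≡ true → Any (λ B → lookup B p ≡ true) Bs)
  atoms [] = [] , [] , [] , λ ()
  atoms (p ∷ ps) with atoms ps
  ... | Bs , u , at , cov with any? (λ B → lookup B p Bool.≟ true) Bs
  ...   | yes p∈ = Bs , u , at , λ { (here refl) _ _ → p∈ ; (there q∈) → cov q∈ }
  ...   | no p∉ with any? (λ y → lookup y p Bool.≟ true) R
  ...     | no none = Bs , u , at , λ { (here refl) y∈ yp → contradiction (lose y∈ yp) none ; (there q∈) → cov q∈ }
  ...     | yes some with find some
  ...       | x , x∈ , xp with separate x∈ xp R id
  ...         | a , a∈ , ap , const = a ∷ Bs ,
    All.tabulate (λ { b∈ refl → p∉ (lose b∈ ap) }) ∷ u ,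
    record { member = a∈ ; nonempty = p , ap ; constant = λ e f y∈ → trans (const e y∈) (sym (const f y∈)) } ∷ at ,
    λ { (here refl) _ _ → here ap ; (there q∈) y∈ yp → there (cov q∈ y∈ yp) }

-- Disjoint blocks and their unions

lookup-ext : {xs ys : Vec X n} → (∀ p → lookup xs p ≡ lookup ys p) → xs ≡ ys
lookup-ext {xs = xs} {ys} eq = trans (sym (tabulate∘lookup xs)) (trans (tabulate-cong eq) (tabulate∘lookup ys))

true-ext : ∀ {a b} → (a ≡ true → b ≡ true) → (b ≡ true → a ≡ true) → a ≡ b
true-ext {true}          f g = sym (f refl)
true-ext {false} {true}  f g = g refl
true-ext {false} {false} f g = refl

lookup-injective : {xs : List X} → Unique xs → ∀ {i j} → List.lookup xs i ≡ List.lookup xs j → i ≡ j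
lookup-injective (x∉ ∷ u) {zero}  {zero}  e = refl
lookup-injective (x∉ ∷ u) {zero}  {suc j} e = contradiction e (All.lookup x∉ (∈-lookup j))
lookup-injective (x∉ ∷ u) {suc i} {zero}  e = contradiction (sym e) (All.lookup x∉ (∈-lookup i))
lookup-injective (x∉ ∷ u) {suc i} {suc j} e = cong suc (lookup-injective u e)

∨-true⁻ : ∀ {a b} → a ∨ b ≡ true → a ≡ true ⊎ b ≡ true
∨-true⁻ {true}  _ = inj₁ refl
∨-true⁻ {false} e = inj₂ e

lookup-⊥ : (p : Fin n) → lookup ⊥ p ≢ true
lookup-⊥ p e with trans (sym (lookup-replicate p false)) e
... | ()

lookup-∪⁻ : (x y : Subset n) (p : Fin n) → lookup (x ∪ y) p ≡ true → lookup x p ≡ true ⊎ lookup y p ≡ true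
lookup-∪⁻ x y p e = ∨-true⁻ (trans (sym (lookup-zipWith _∨_ p x y)) e)

lookup-∪⁺ˡ : (x y : Subset n) (p : Fin n) → lookup x p ≡ true → lookup (x ∪ y) p ≡ true
lookup-∪⁺ˡ x y p e = trans (lookup-zipWith _∨_ p x y) (cong (_∨ lookup y p) e)

lookup-∪⁺ʳ : (x y : Subset n) (p : Fin n) → lookup y p ≡ true → lookup (x ∪ y) p ≡ true
lookup-∪⁺ʳ x y p e = trans (lookup-zipWith _∨_ p x y)
  (trans (cong (lookup x p ∨_) e) (Bool.∨-zeroʳ (lookup x p)))

lookup-⋃⁺ : (S : Subset k) (B : Fin k → Subset n) {l : Fin k} {p : Fin n} →
  lookup S l ≡ true → lookup (B l) p ≡ true → lookup (⋃[ S ] B) p ≡ true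
lookup-⋃⁺ (true ∷ S) B {zero}  {p} refl Bp = lookup-∪⁺ˡ (B zero) (⋃[ S ] (B ∘ suc)) p Bp
lookup-⋃⁺ (b ∷ S)    B {suc l} {p} Sl   Bp =
  lookup-∪⁺ʳ (if b then B zero else ⊥) (⋃[ S ] (B ∘ suc)) p (lookup-⋃⁺ S (B ∘ suc) Sl Bp)

lookup-⋃⁻ : (S : Subset k) (B : Fin k → Subset n) {p : Fin n} →
  lookup (⋃[ S ] B) p ≡ true → ∃ λ l → lookup S l ≡ true × lookup (B l) p ≡ true
lookup-⋃⁻ []      B {p} e = contradiction e (lookup-⊥ p)
lookup-⋃⁻ (b ∷ S) B {p} e with lookup-∪⁻ (if b then B zero else ⊥) (⋃[ S ] (B ∘ suc)) p e
lookup-⋃⁻ (true ∷ S)  B {p} e | inj₁ Bp = zero , refl , Bp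
lookup-⋃⁻ (false ∷ S) B {p} e | inj₁ Bp = contradiction Bp (lookup-⊥ p)
... | inj₂ e′ with lookup-⋃⁻ S (B ∘ suc) e′
...   | l , Sl , Bp = suc l , Sl , Bp

Separated : (Fin k → Subset n) → Set
Separated B = ∀ {i j p} → lookup (B i) p ≡ true → lookup (B j) p ≡ true → i ≡ j

Union : (Fin k → Subset n) → Subset n → Set
Union B x = ∃ λ S → x ≡ ⋃[ S ] B

-- Weaker than `Union`: points outside all blocks are unrestricted. For odd n this leaves exactly
-- the freedom at the uncovered point.
Constant : (Fin k → Subset n) → Subset n → Set
Constant B x = ∀ {l p q} → lookup (B l) p ≡ true → lookup (B l) q ≡ true → lookup x p ≡ lookup x q

-- By constancy a block that meets `x` lies inside it, so `x` is the union of the blocks it meets.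
constant⇒union : {B : Fin k → Subset n} {x : Subset n} → Constant B x →
  (∀ {p} → lookup x p ≡ true → ∃ λ l → lookup (B l) p ≡ true) → Union B x
constant⇒union {B = B} {x} const cov = S , lookup-ext λ p → true-ext ⊆S S⊆
  where
  meets? : ∀ l → Dec (∃ λ p → lookup (B l) p ≡ true × lookup x p ≡ true)
  meets? l = Fin.any? λ p → (lookup (B l) p Bool.≟ true) ×-dec (lookup x p Bool.≟ true)
  S = Vec.tabulate (λ l → does (meets? l))
  ⊆S : ∀ {p} → lookup x p ≡ true → lookup (⋃[ S ] B) p ≡ true
  ⊆S {p} xp with cov xp
  ... | l , Bp = lookup-⋃⁺ S B (trans (lookup∘tabulate _ l) Sl) Bp
    where
    Sl : does (meets? l) ≡ true
    Sl with meets? l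
    ... | yes _ = refl
    ... | no f  = contradiction (p , Bp , xp) f
  S⊆ : ∀ {p} → lookup (⋃[ S ] B) p ≡ true → lookup x p ≡ true
  S⊆ {p} e with lookup-⋃⁻ S B e
  ... | l , Sl , Bp with meets? l | trans (sym (lookup∘tabulate (λ l → does (meets? l)) l)) Sl
  ...   | yes (q , Bq , xq) | _ = trans (const Bp Bq) xq

union⇒constant : {B : Fin k → Subset n} {x : Subset n} → Separated B → Union B x → Constant B x
union⇒constant {B = B} sep (S , refl) Bp Bq = true-ext (go Bp Bq) (go Bq Bp)
  where
  go : ∀ {l p q} → lookup (B l) p ≡ true → lookup (B l) q ≡ true →
    lookup (⋃[ S ] B) p ≡ true → lookup (⋃[ S ] B) q ≡ true
  go Bp Bq e with lookup-⋃⁻ S B e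
  ... | l′ , Sl′ , Bl′p with sep Bp Bl′p
  ...   | refl = lookup-⋃⁺ S B Sl′ Bq

∣∪∣-disjoint : (x y : Subset n) → (∀ {p} → lookup x p ≡ true → lookup y p ≢ true) → ∣ x ∪ y ∣ ≡ ∣ x ∣ + ∣ y ∣
∣∪∣-disjoint []          []          _    = refl
∣∪∣-disjoint (true ∷ x)  (true ∷ y)  disj = contradiction refl (disj {zero} refl)
∣∪∣-disjoint (true ∷ x)  (false ∷ y) disj = cong suc (∣∪∣-disjoint x y λ {p} → disj {suc p})
∣∪∣-disjoint (false ∷ x) (true ∷ y)  disj =
  trans (cong suc (∣∪∣-disjoint x y λ {p} → disj {suc p})) (sym (+-suc ∣ x ∣ ∣ y ∣))
∣∪∣-disjoint (false ∷ x) (false ∷ y) disj = ∣∪∣-disjoint x y λ {p} → disj {suc p}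

∣⋃∣-∷ : {B : Fin (suc k) → Subset n} → Separated B → (S : Subset k) →
  ∣ B zero ∪ ⋃[ S ] (B ∘ suc) ∣ ≡ ∣ B zero ∣ + ∣ ⋃[ S ] (B ∘ suc) ∣
∣⋃∣-∷ {B = B} sep S = ∣∪∣-disjoint (B zero) (⋃[ S ] (B ∘ suc)) disj
  where
  disj : ∀ {p} → lookup (B zero) p ≡ true → lookup (⋃[ S ] (B ∘ suc)) p ≢ true
  disj Bp e with lookup-⋃⁻ S (B ∘ suc) e
  ... | l , _ , Bl with sep Bp Bl
  ...   | ()

separated-suc : {B : Fin (suc k) → Subset n} → Separated B → Separated (B ∘ suc)
separated-suc sep Bi Bj = Fin.suc-injective (sep Bi Bj)

*∣S∣≤∣⋃∣ : ∀ {c} {B : Fin k → Subset n} → Separated B → (∀ l → c ≤ ∣ B l ∣) →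
  ∀ S → c * ∣ S ∣ ≤ ∣ ⋃[ S ] B ∣
*∣S∣≤∣⋃∣ {c = c} sep c≤ [] = ≤-trans (≤-reflexive (*-zeroʳ c)) z≤n
*∣S∣≤∣⋃∣ {c = c} {B} sep c≤ (true ∷ S) = begin
  c * suc ∣ S ∣                        ≡⟨ *-suc c ∣ S ∣ ⟩
  c + c * ∣ S ∣                        ≤⟨ +-mono-≤ (c≤ zero) (*∣S∣≤∣⋃∣ (separated-suc {B = B} sep) (c≤ ∘ suc) S) ⟩
  ∣ B zero ∣ + ∣ ⋃[ S ] (B ∘ suc) ∣    ≡⟨ ∣⋃∣-∷ {B = B} sep S ⟨
  ∣ B zero ∪ ⋃[ S ] (B ∘ suc) ∣        ∎
  where open ≤-Reasoning
*∣S∣≤∣⋃∣ {c = c} {B} sep c≤ (false ∷ S) = subst (λ x → c * ∣ S ∣ ≤ ∣ x ∣)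
  (sym (∪-identityˡ (⋃[ S ] (B ∘ suc)))) (*∣S∣≤∣⋃∣ (separated-suc {B = B} sep) (c≤ ∘ suc) S)

∣⋃∣≡*∣S∣ : ∀ {c} {B : Fin k → Subset n} → Separated B → (∀ l → ∣ B l ∣ ≡ c) →
  ∀ S → ∣ ⋃[ S ] B ∣ ≡ c * ∣ S ∣
∣⋃∣≡*∣S∣ {n = n} {c = c} sep ≡c [] = trans (∣⊥∣≡0 n) (sym (*-zeroʳ c))
∣⋃∣≡*∣S∣ {c = c} {B} sep ≡c (true ∷ S) = begin
  ∣ B zero ∪ ⋃[ S ] (B ∘ suc) ∣        ≡⟨ ∣⋃∣-∷ {B = B} sep S ⟩
  ∣ B zero ∣ + ∣ ⋃[ S ] (B ∘ suc) ∣
    ≡⟨ cong₂ _+_ (≡c zero) (∣⋃∣≡*∣S∣ (separated-suc {B = B} sep) (≡c ∘ suc) S) ⟩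
  c + c * ∣ S ∣                        ≡⟨ *-suc c ∣ S ∣ ⟨
  c * suc ∣ S ∣                        ∎
  where open ≡-Reasoning
∣⋃∣≡*∣S∣ {c = c} {B} sep ≡c (false ∷ S) = trans (cong ∣_∣ (∪-identityˡ (⋃[ S ] (B ∘ suc))))
  (∣⋃∣≡*∣S∣ (separated-suc {B = B} sep) (≡c ∘ suc) S)

-- Parity, sizes and pairings

mutual
  parity-false⇒2∣ : (x : Subset n) → parity x ≡ false → 2 ∣ ∣ x ∣
  parity-false⇒2∣ []          _ = 2 ∣0
  parity-false⇒2∣ (true ∷ x)  e = parity-true⇒2∣1+ x (Bool.not-injective e)
  parity-false⇒2∣ (false ∷ x) e = parity-false⇒2∣ x e

  parity-true⇒2∣1+ : (x : Subset n) → parity x ≡ true → 2 ∣ (suc ∣ x ∣)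
  parity-true⇒2∣1+ (true ∷ x)  e = ∣m∣n⇒∣m+n {2} {2} ∣-refl (parity-false⇒2∣ x (Bool.not-injective e))
  parity-true⇒2∣1+ (false ∷ x) e = parity-true⇒2∣1+ x e

2∣⇒parity-false : (x : Subset n) → 2 ∣ ∣ x ∣ → parity x ≡ false
2∣⇒parity-false x d = ≢true⇒≡false λ e →
  contradiction (∣⇒≤ (∣m+n∣m⇒∣n (subst (2 ∣_) (+-comm 1 ∣ x ∣) (parity-true⇒2∣1+ x e)) d)) λ { (s≤s ()) }

nonempty⇒0<∣∣ : (x : Subset n) {p : Fin n} → lookup x p ≡ true → 0 < ∣ x ∣
nonempty⇒0<∣∣ (true ∷ x)  {p}     e = s≤s z≤n
nonempty⇒0<∣∣ (false ∷ x) {suc p} e = nonempty⇒0<∣∣ x e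

lookup-⁅⁆⁺ : (p : Fin n) → lookup ⁅ p ⁆ p ≡ true
lookup-⁅⁆⁺ p = []=⇒lookup (x∈⁅x⁆ p)

lookup-⁅⁆⁻ : {p q : Fin n} → lookup ⁅ p ⁆ q ≡ true → q ≡ p
lookup-⁅⁆⁻ {p = p} {q} e = x∈⁅y⁆⇒x≡y p (lookup⇒[]= q ⁅ p ⁆ e)

-- The blocks are not asked to cover the ground set; with ⌊n/2⌋ of them, counting shows that at most
-- one point is left over.
IsPerfectPairing : (Fin k → Subset n) → Set
IsPerfectPairing B = Separated B × ∀ l → ∣ B l ∣ ≡ 2

-- An even block of another size has at least four points; with two in each other block, the total
-- would be at least 2 (k + 1), which exceeds n.
even-blocks⇒size2 : (B : Fin k → Subset n) → Separated B → (∀ l → 2 ∣ ∣ B l ∣) → (∀ l → 2 ≤ ∣ B l ∣) →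
  n < 2 * suc k → ∀ l → ∣ B l ∣ ≡ 2
even-blocks⇒size2 {suc k} {n} B sep 2∣ 2≤ n< l = squeeze (2∣ l) (2≤ l) (+-cancelʳ-< (2 * k) ∣ B l ∣ 4 (begin-strict
  ∣ B l ∣ + 2 * k               ≡⟨ cong (λ c → ∣ B l ∣ + 2 * c) card-rest ⟨
  ∣ B l ∣ + 2 * ∣ rest ∣        ≤⟨ +-monoʳ-≤ ∣ B l ∣ (*∣S∣≤∣⋃∣ {B = B} sep 2≤ rest) ⟩
  ∣ B l ∣ + ∣ ⋃[ rest ] B ∣     ≡⟨ ∣∪∣-disjoint (B l) (⋃[ rest ] B) disj ⟨
  ∣ B l ∪ ⋃[ rest ] B ∣         ≤⟨ ∣p∣≤n (B l ∪ ⋃[ rest ] B) ⟩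
  n                             <⟨ n< ⟩
  2 * suc (suc k)               ≡⟨ *-distribˡ-+ 2 2 k ⟩
  4 + 2 * k                     ∎))
  where
  open ≤-Reasoning
  rest = ∁ ⁅ l ⁆
  card-rest : ∣ rest ∣ ≡ k
  card-rest = trans (∣∁p∣≡n∸∣p∣ ⁅ l ⁆) (cong (suc k ∸_) (∣⁅x⁆∣≡1 l))
  disj : ∀ {p} → lookup (B l) p ≡ true → lookup (⋃[ rest ] B) p ≢ true
  disj Bp e with lookup-⋃⁻ rest B e
  ... | j , j∈ , Bj with sep Bp Bj
  ...   | refl with trans (sym j∈) (trans (lookup-map l _ ⁅ l ⁆) (cong not (lookup-⁅⁆⁺ l)))
  ...     | ()
  squeeze : ∀ {c} → 2 ∣ c → 2 ≤ c → c < 4 → c ≡ 2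
  squeeze (divides 1 refl) _ _ = refl
  squeeze (divides (suc (suc q)) refl) _ (s≤s (s≤s (s≤s (s≤s ()))))

-- Let d be the number of atoms. Members of `L` are unions of atoms, so 2^d is at least the size of
-- `L`, which gives d ≥ ⌊n/2⌋; disjoint atoms with at least two points each give d ≤ ⌊n/2⌋. The
-- equality also transports the index type.
evenRing⇒pairing : {L R : List (Subset n)} → Unique L → IsEvenRing R → L ⊆ R → 2 ^ ⌊ n /2⌋ < 2 * length L →
  ∃ λ (B : Fin ⌊ n /2⌋ → Subset n) → IsPerfectPairing B × (∀ {x} → x ∈ L → Union B x)
evenRing⇒pairing {n} {L} {R} uL ring L⊆R big with atoms ring (allFin n)
... | Bs , u , at , cov = subst (λ d → ∃ λ (B : Fin d → Subset n) → IsPerfectPairing B × (∀ {x} → x ∈ L → Union B x))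
  d≡ (B , (sep , even-blocks⇒size2 B sep 2∣B 2≤B n<) , union)
  where
  open ≤-Reasoning
  B = List.lookup Bs
  atom : ∀ l → IsAtom R (B l)
  atom l = All.lookup at (∈-lookup l)
  sep : Separated B
  sep {i} {j} Bi Bj = lookup-injective u (lookup-ext λ q → true-ext
    (λ e → trans (sym (IsAtom.constant (atom i) Bi e (IsAtom.member (atom j)))) Bj)
    (λ e → trans (sym (IsAtom.constant (atom j) Bj e (IsAtom.member (atom i)))) Bi))
  2∣B : ∀ l → 2 ∣ ∣ B l ∣
  2∣B l = parity-false⇒2∣ (B l) (IsEvenRing.even ring (IsAtom.member (atom l)))
  2≤B : ∀ l → 2 ≤ ∣ B l ∣
  2≤B l with IsAtom.nonempty (atom l)
  ... | p , Bp = ∣⇒≤ {{>-nonZero (nonempty⇒0<∣∣ (B l) Bp)}} (2∣B l)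
  union : ∀ {x} → x ∈ L → Union B x
  union x∈ = constant⇒union (λ {l} Bp Bq → IsAtom.constant (atom l) Bp Bq (L⊆R x∈)) λ xp →
    let a = cov (∈-allFin _) (L⊆R x∈) xp in Any.index a , Any.lookup-index a
  codes = map (λ S → ⋃[ S ] B) (subsets (length Bs))
  L⊆codes : L ⊆ codes
  L⊆codes x∈ with union x∈
  ... | S , refl = ∈-map⁺ _ (∈-subsets S)
  ⌊n/2⌋≤d : ⌊ n /2⌋ ≤ length Bs
  ⌊n/2⌋≤d = ≤-pred (2^-cancel-< (begin-strict
    2 ^ ⌊ n /2⌋                   <⟨ big ⟩
    2 * length L                  ≤⟨ *-monoʳ-≤ 2 (unique⇒length≤ uL L⊆codes) ⟩
    2 * length codes              ≡⟨ cong (2 *_) (trans (length-map _ (subsets (length Bs))) (length-subsets (length Bs))) ⟩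
    2 ^ suc (length Bs)           ∎))
  d≤⌊n/2⌋ : length Bs ≤ ⌊ n /2⌋
  d≤⌊n/2⌋ = ≤-pred (*-cancelˡ-< 2 (length Bs) (suc ⌊ n /2⌋) (begin-strict
    2 * length Bs                  ≡⟨ cong (2 *_) (∣⊤∣≡n (length Bs)) ⟨
    2 * ∣ ⊤ {length Bs} ∣          ≤⟨ *∣S∣≤∣⋃∣ {B = B} sep 2≤B ⊤ ⟩
    ∣ ⋃[ ⊤ ] B ∣                   ≤⟨ ∣p∣≤n (⋃[ ⊤ ] B) ⟩
    n                              <⟨ n<2*[1+⌊n/2⌋] n ⟩
    2 * suc ⌊ n /2⌋                ∎))
  d≡ : length Bs ≡ ⌊ n /2⌋
  d≡ = ≤-antisym d≤⌊n/2⌋ ⌊n/2⌋≤d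
  n< : n < 2 * suc (length Bs)
  n< = subst (λ d → n < 2 * suc d) (sym d≡) (n<2*[1+⌊n/2⌋] n)

-- Finite search, padding and greedy deletion

take-⊆ : ∀ k (xs : List X) → take k xs ⊆ xs
take-⊆ k xs = All.lookup (All.take⁺ k (All.tabulate id))

-- Makes the existence of an odd tuple decidable, so that one of maximal size can be chosen
-- constructively. Tuples may repeat entries; the caller excludes this through `P`.
search : ∀ t (L : List X) {P : List X → Set} → Decidable P → Dec (∃ λ T → length T ≡ t × T ⊆ L × P T)
search zero L P? with P? []
... | yes p = yes ([] , refl , (λ ()) , p)
... | no ¬p = no λ { ([] , refl , _ , p) → ¬p p }
search (suc t) L P? with any? (λ x → search t L (P? ∘ (x ∷_))) L
... | yes some with find some
...   | x , x∈ , T , refl , T⊆ , p = yes (x ∷ T , refl , (λ { (here refl) → x∈ ; (there y∈) → T⊆ y∈ }) , p)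
search (suc t) L P? | no none =
  no λ { (x ∷ T , refl , T⊆ , p) → none (lose (T⊆ (here refl)) (T , refl , T⊆ ∘ there , p)) }

-- Used twice: to lengthen a two-set intersection to the required number of sets, and to fill up the
-- list of sets C in type (ii).
pad : {Q W : List (Subset n)} → Unique Q → Unique W → length Q ≤ k → k ≤ length W →
  ∃ λ T → Unique T × length T ≡ k × Q ⊆ T × (∀ {x} → x ∈ T → x ∈ Q ⊎ x ∈ W)
pad {k = k} {Q = Q} {W} uQ uW Q≤k k≤W = T , Unique.++⁺ uQ (Unique.take⁺ r (Unique.filter⁺ new? uW)) disj ,
  len , ∈-++⁺ˡ , from
  where
  open ≤-Reasoning
  new? = λ x → ¬? (x ∈? Q)
  r = k ∸ length Q
  W′ = filter new? W
  T = Q ++ take r W′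
  disj : Disjoint Q (take r W′)
  disj (x∈Q , x∈) = proj₂ (∈-filter⁻ new? {xs = W} (take-⊆ r W′ x∈)) x∈Q
  from : ∀ {x} → x ∈ T → x ∈ Q ⊎ x ∈ W
  from x∈ with ∈-++⁻ Q x∈
  ... | inj₁ x∈Q = inj₁ x∈Q
  ... | inj₂ x∈′ = inj₂ (proj₁ (∈-filter⁻ new? {xs = W} (take-⊆ r W′ x∈′)))
  W⊆ : W ⊆ Q ++ W′
  W⊆ {x} x∈ with x ∈? Q
  ... | yes x∈Q = ∈-++⁺ˡ x∈Q
  ... | no x∉Q  = ∈-++⁺ʳ Q (∈-filter⁺ new? x∈ x∉Q)
  r≤ : r ≤ length W′
  r≤ = m≤n+o⇒m∸n≤o k (length Q) (begin
    k                      ≤⟨ k≤W ⟩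
    length W               ≤⟨ unique⇒length≤ uW W⊆ ⟩
    length (Q ++ W′)       ≡⟨ length-++ Q ⟩
    length Q + length W′   ∎)
  len : length T ≡ k
  len = trans (length-++ Q) (trans (cong (length Q +_) (trans (length-take r W′) (m≤n⇒m⊓n≡m r≤))) (m+[n∸m]≡n Q≤k))

-- The sizes run over a half-open interval, open at `a`. With `b` fixed at k, the hypothesis is the
-- case `a` = k - 1, and the deletion lowers `a` to 0.
EvenBetween : ℕ → ℕ → List (Subset n) → Set
EvenBetween a b L = ∀ {T} → Unique T → T ⊆ L → a < length T → length T ≤ b → parity (⋂ T) ≡ false

-- As long as some intersection is odd, remove an odd tuple T of maximal size. By maximality ⋂ T has even
-- intersection with every remaining set, so pairing ⋂ T with a member of T gives a triangular
-- list, whose length is at most n.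
strong-core : ∀ K t fuel (L : List (Subset n)) → Unique L → length L ≤ fuel → t ≤ K → EvenBetween t (suc K) L →
  ∃ λ s → ∃ λ L′ → Triangular s × All (λ a → proj₂ a ∈ L) s × Unique L′ × L′ ⊆ L ×
    length L ≤ length L′ + K * length s × EvenBetween 0 (suc K) L′
strong-core K zero fuel L u _ _ ev = [] , L , ([] , []) , [] , u , id , m≤m+n (length L) _ , ev
strong-core K (suc t) fuel L u L≤ t<K ev
  with search (suc t) L (λ T → DecUnique.unique? _≟ˢ_ T ×-dec (parity (⋂ T) Bool.≟ true))
-- Only when no odd tuple of this size is left does the lower end of the interval drop; after a
-- deletion the same size is searched again.
strong-core K (suc t) fuel L u L≤ t<K ev | no none = strong-core K t fuel L u L≤ (<⇒≤ t<K) ev′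
  where
  ev′ : EvenBetween t (suc K) L
  ev′ {T} uT T⊆ t<T T≤ with m≤n⇒m<n∨m≡n t<T
  ... | inj₁ 1+t<T = ev uT T⊆ 1+t<T T≤
  ... | inj₂ 1+t≡T = ≢true⇒≡false λ e → none (T , sym 1+t≡T , T⊆ , uT , e)
strong-core K (suc t) zero [] u L≤ t<K ev | yes (x ∷ T , _ , T⊆ , _) = contradiction (T⊆ (here refl)) λ ()
strong-core {n} K (suc t) (suc fuel) L u L≤ t<K ev | yes (x ∷ T , lenT , T⊆ , uT , odd)
  with strong-core K (suc t) fuel L₁ (Unique.filter⁺ new? u) L₁≤ t<K ev₁
  where
  new? = λ y → ¬? (y ∈? (x ∷ T))
  L₁ = filter new? L
  L₁≤ : length L₁ ≤ fuel
  L₁≤ = ≤-pred (≤-trans (filter-notAll new? L (lose (T⊆ (here refl)) λ f → f (here refl))) L≤)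
  ev₁ : EvenBetween (suc t) (suc K) L₁
  ev₁ uT′ T′⊆ = ev uT′ (λ y∈ → proj₁ (∈-filter⁻ new? {xs = L} (T′⊆ y∈)))
... | s , L′ , (d , tr) , s⊆ , u′ , L′⊆ , len , ev′ =
  -- One pair is recorded for a whole deleted tuple of at most `K` sets, hence the factor `K` in the
  -- count.
  (⋂ (x ∷ T) , x) ∷ s , L′ , (diag ∷ d , All.map (λ {a} → off {a}) s⊆ ∷ tr) ,
  T⊆ (here refl) ∷ All.map L₁⊆ s⊆ , u′ , L₁⊆ ∘ L′⊆ , len′ , ev′
  where
  open ≤-Reasoning
  new? = λ y → ¬? (y ∈? (x ∷ T))
  L₁ = filter new? L
  L₁⊆ : L₁ ⊆ L
  L₁⊆ y∈ = proj₁ (∈-filter⁻ new? {xs = L} y∈)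
  diag : ⋂ (x ∷ T) · x ≡ true
  diag = trans (cong parity (trans (cong (_∩ x) (∩-comm x (⋂ T)))
    (trans (∩-assoc (⋂ T) x x) (trans (cong (⋂ T ∩_) (∩-idem x)) (∩-comm (⋂ T) x))))) odd
  off : ∀ {a : Subset n × Subset n} → proj₂ a ∈ L₁ → ⋂ (x ∷ T) · proj₂ a ≡ false
  off {_ , y} y∈ = trans (·-comm (⋂ (x ∷ T)) y)
    -- Adding `y` gives a tuple one larger than the odd one, a size at which evenness is already
    -- known.
    (ev {y ∷ x ∷ T} (All.tabulate (λ { z∈ refl → y∉ z∈ }) ∷ uT)
      (λ { (here refl) → L₁⊆ y∈ ; (there z∈) → T⊆ z∈ })
      (s≤s (≤-reflexive (sym lenT))) (s≤s (≤-trans (≤-reflexive lenT) t<K)))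
    where
    y∉ = proj₂ (∈-filter⁻ new? {xs = L} y∈)
  L⊆ : L ⊆ (x ∷ T) ++ L₁
  L⊆ {y} y∈ with y ∈? (x ∷ T)
  ... | yes y∈T = ∈-++⁺ˡ y∈T
  ... | no y∉T  = ∈-++⁺ʳ (x ∷ T) (∈-filter⁺ new? y∈ y∉T)
  len′ : length L ≤ length L′ + K * suc (length s)
  len′ = begin
    length L                                ≤⟨ unique⇒length≤ u L⊆ ⟩
    length ((x ∷ T) ++ L₁)                  ≡⟨ length-++ (x ∷ T) ⟩
    length (x ∷ T) + length L₁              ≤⟨ +-mono-≤ (≤-trans (≤-reflexive lenT) t<K) len ⟩
    K + (length L′ + K * length s)          ≡⟨ +-comm K _ ⟩
    (length L′ + K * length s) + K          ≡⟨ +-assoc (length L′) _ K ⟩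
    length L′ + (K * length s + K)          ≡⟨ cong (length L′ +_) (trans (+-comm _ K) (sym (*-suc K (length s)))) ⟩
    length L′ + K * suc (length s)          ∎

-- Coinciding arguments collapse to an intersection of one or two sets, so evenness is needed at
-- sizes one, two and three; `3 ≤ k` puts all of them in range.
strong⇒trilinear : {L : List (Subset n)} → 3 ≤ k → EvenBetween 0 k L → Trilinear L
strong⇒trilinear {L = L} 3≤k ev {x} {y} {z} x∈ y∈ z∈ = triple
  where
  ∩-⊤ : (a : Subset _) → a ∩ ⊤ ≡ a
  ∩-⊤ = zipWith-identityʳ Bool.∧-identityʳ
  single : ∀ {a} → a ∈ L → parity a ≡ false
  single {a} a∈ = trans (cong parity (sym (∩-⊤ a)))
    (ev {a ∷ []} ([] ∷ []) (λ { (here refl) → a∈ }) (s≤s z≤n) (≤-trans (s≤s z≤n) 3≤k))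
  pair : ∀ {a b} → a ∈ L → b ∈ L → a · b ≡ false
  pair {a} {b} a∈ b∈ with a ≟ˢ b
  ... | yes refl = trans (cong parity (∩-idem a)) (single a∈)
  ... | no a≢b = trans (cong (λ c → parity (a ∩ c)) (sym (∩-⊤ b)))
    (ev {a ∷ b ∷ []} ((a≢b ∷ []) ∷ [] ∷ []) (λ { (here refl) → a∈ ; (there (here refl)) → b∈ })
      (s≤s z≤n) (≤-trans (s≤s (s≤s z≤n)) 3≤k))
  triple : (x ∩ y) · z ≡ false
  triple with x ≟ˢ y | x ≟ˢ z | y ≟ˢ z
  ... | yes refl | _ | _ = trans (cong (_· z) (∩-idem x)) (pair x∈ z∈)
  ... | _ | yes refl | _ = trans (∩-·-rotate x y x) (trans (cong (_· y) (∩-idem x)) (pair x∈ y∈))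
  ... | _ | _ | yes refl = trans (cong parity (trans (∩-assoc x y y) (cong (x ∩_) (∩-idem y)))) (pair x∈ y∈)
  ... | no x≢y | no x≢z | no y≢z =
    trans (cong parity (trans (∩-assoc x y z) (cong (λ c → x ∩ (y ∩ c)) (sym (∩-⊤ z)))))
    (ev {x ∷ y ∷ z ∷ []} ((x≢y ∷ x≢z ∷ []) ∷ (y≢z ∷ []) ∷ [] ∷ [])
      (λ { (here refl) → x∈ ; (there (here refl)) → y∈ ; (there (there (here refl))) → z∈ })
      (s≤s z≤n) 3≤k)

-- From lists of members to index sets

∣[]≔∣ : (S : Subset m) (i : Fin m) → lookup S i ≡ false → ∣ S [ i ]≔ true ∣ ≡ suc ∣ S ∣
∣[]≔∣ (false ∷ S) zero    _ = refl
∣[]≔∣ (true ∷ S)  (suc i) e = cong suc (∣[]≔∣ S i e)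
∣[]≔∣ (false ∷ S) (suc i) e = ∣[]≔∣ S i e

⋂-[]≔ : (S : Subset m) (A : Fin m → Subset n) (i : Fin m) → lookup S i ≡ false →
  ⋂[ S [ i ]≔ true ] A ≡ A i ∩ ⋂[ S ] A
⋂-[]≔ (false ∷ S) A zero e = cong (A zero ∩_) (sym (zipWith-identityˡ Bool.∧-identityˡ _))
⋂-[]≔ (b ∷ S) A (suc i) e = begin
  a ∩ ⋂[ S [ i ]≔ true ] (A ∘ suc)     ≡⟨ cong (a ∩_) (⋂-[]≔ S (A ∘ suc) i e) ⟩
  a ∩ (A (suc i) ∩ r)                  ≡⟨ ∩-assoc a (A (suc i)) r ⟨
  (a ∩ A (suc i)) ∩ r                  ≡⟨ cong (_∩ r) (∩-comm a (A (suc i))) ⟩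
  (A (suc i) ∩ a) ∩ r                  ≡⟨ ∩-assoc (A (suc i)) a r ⟩
  A (suc i) ∩ (a ∩ r)                  ∎
  where
  open ≡-Reasoning
  a = if b then A zero else ⊤
  r = ⋂[ S ] (A ∘ suc)

⋂[⊥] : (A : Fin m → Subset n) → ⋂[ ⊥ ] A ≡ ⊤
⋂[⊥] {zero}  A = refl
⋂[⊥] {suc m} A = trans (zipWith-identityˡ Bool.∧-identityˡ _) (⋂[⊥] (A ∘ suc))

-- The last component is the invariant of the induction: it shows that the index of a new set has
-- not been chosen before.
indices : (A : Fin m → Subset n) {T : List (Subset n)} → Unique T → T ⊆ tabulate A →
  ∃ λ S → ∣ S ∣ ≡ length T × ⋂[ S ] A ≡ ⋂ T × (∀ i → lookup S i ≡ true → A i ∈ T)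
indices {m} A {[]} _ _ = ⊥ , ∣⊥∣≡0 m , ⋂[⊥] A , λ i e → contradiction e (lookup-⊥ i)
indices A {x ∷ T} (x∉ ∷ u) T⊆ with indices A u (T⊆ ∘ there) | ∈-tabulate⁻ {f = A} (T⊆ (here refl))
... | S , card , inter , mem | i , refl = S [ i ]≔ true ,
  trans (∣[]≔∣ S i i∉) (cong suc card) , trans (⋂-[]≔ S A i i∉) (cong (A i ∩_) inter) , mem′
  where
  i∉ : lookup S i ≡ false
  i∉ = ≢true⇒≡false λ e → contradiction refl (All.lookup x∉ (mem i e))
  mem′ : ∀ j → lookup (S [ i ]≔ true) j ≡ true → A j ∈ A i ∷ T
  mem′ j e with j Fin.≟ i
  ... | yes refl = here refl
  ... | no j≢i   = there (mem j (trans (sym (lookup∘update′ j≢i S true)) e))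

eventown-⋂ : {A : Fin m → Subset n} → IsKWiseEventown k A → {T : List (Subset n)} → Unique T → T ⊆ tabulate A →
  length T ≡ k → parity (⋂ T) ≡ false
eventown-⋂ {A = A} (_ , ev) {T} u T⊆ len with indices A u T⊆
... | S , card , inter , _ = trans (cong parity (sym inter))
  (2∣⇒parity-false (⋂[ S ] A) (ev S (trans card len)))

-- Pairs as intersections of members

lookup-⋂⁺ : (T : List (Subset n)) {p : Fin n} → (∀ {x} → x ∈ T → lookup x p ≡ true) → lookup (⋂ T) p ≡ true
lookup-⋂⁺ []      {p} all = lookup-replicate p true
lookup-⋂⁺ (x ∷ T) {p} all = lookup-∩⁺ x (⋂ T) p (all (here refl)) (lookup-⋂⁺ T (all ∘ there))

lookup-⋂⁻ : {T : List (Subset n)} {p : Fin n} → lookup (⋂ T) p ≡ true → ∀ {x} → x ∈ T → lookup x p ≡ true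
lookup-⋂⁻ {T = x ∷ T} {p} e (here refl) = proj₁ (lookup-∩⁻ x (⋂ T) p e)
lookup-⋂⁻ {T = x ∷ T} {p} e (there y∈)  = lookup-⋂⁻ (proj₂ (lookup-∩⁻ x (⋂ T) p e)) y∈

constant-⊕ : {B : Fin k → Subset n} {x y : Subset n} → Constant B x → Constant B y → Constant B (x ⊕ y)
constant-⊕ {x = x} {y} cx cy {l} {p} {q} Bp Bq =
  trans (lookup-⊕ x y p) (trans (cong₂ _xor_ (cx Bp Bq) (cy Bp Bq)) (sym (lookup-⊕ x y q)))

constant-⋂ : {B : Fin k → Subset n} {T : List (Subset n)} → (∀ {x} → x ∈ T → Constant B x) → Constant B (⋂ T)
constant-⋂ {T = T} c Bp Bq = true-ext
  (λ e → lookup-⋂⁺ T λ x∈ → trans (sym (c x∈ Bp Bq)) (lookup-⋂⁻ e x∈))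
  (λ e → lookup-⋂⁺ T λ x∈ → trans (c x∈ Bp Bq) (lookup-⋂⁻ e x∈))

xor-true⁻ : ∀ {a b} → a xor b ≡ true → a ≡ true ⊎ b ≡ true
xor-true⁻ {true}  _ = inj₁ refl
xor-true⁻ {false} e = inj₂ e

∣∣≡2⇒nonempty : (x : Subset n) → ∣ x ∣ ≡ 2 → ∃ λ p → lookup x p ≡ true
∣∣≡2⇒nonempty {n} x e = ≢⊥⇒nonempty x λ { refl → contradiction (trans (sym (∣⊥∣≡0 n)) e) λ () }

another : (i : Fin (suc (suc k))) → ∃ λ j → j ≢ i
another zero    = suc zero , λ ()
another (suc _) = zero , λ ()

-- More than half of the unions containing B l lie in L, so L contains such a union Y together
-- with its complement Y ⊕ (⋃ B ⊕ B l) among them; these two meet exactly in B l.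
⋂≡block : {B : Fin k → Subset n} → IsPerfectPairing B → {L : List (Subset n)} → Unique L →
  (∀ {x} → x ∈ L → Union B x) → 3 * 2 ^ k < 4 * length L → 2 ≤ k →
  ∀ {K} → 2 ≤ K → K ≤ 2 ^ (k ∸ 2) → ∀ l → ∃ λ T → Unique T × T ⊆ L × length T ≡ K × ⋂ T ≡ B l
⋂≡block {suc zero} _ _ _ _ (s≤s ())
⋂≡block {suc (suc e)} {B = B} (sep , size) {L} uL L⊆ big 2≤k {K} 2≤K K≤ l = result
  where
  open ≤-Reasoning
  p₀ = proj₁ (∣∣≡2⇒nonempty (B l) (size l))
  Bp₀ = proj₂ (∣∣≡2⇒nonempty (B l) (size l))
  -- `F true` lists the unions that contain `B l` and `F false` those that avoid it, half of all
  -- each; the point `p₀` tells them apart.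
  F : Bool → List (Subset _)
  F b = map (λ S → ⋃[ insertAt S l b ] B) (subsets (suc e))
  length-F : ∀ b → length (F b) ≡ 2 ^ suc e
  length-F b = trans (length-map _ (subsets (suc e))) (length-subsets (suc e))
  ∈-F : ∀ {x} → Union B x → x ∈ F (lookup x p₀)
  ∈-F (S , refl) = subst₂ (λ b T → ⋃[ S ] B ∈ map (λ S → ⋃[ insertAt S l b ] B) T) bit refl
    (subst (λ S′ → ⋃[ S′ ] B ∈ F (lookup S l)) (insertAt-removeAt S l)
      (∈-map⁺ (λ S → ⋃[ insertAt S l _ ] B) (∈-subsets (removeAt S l))))
    where
    bit : lookup S l ≡ lookup (⋃[ S ] B) p₀
    bit = true-ext (λ Sl → lookup-⋃⁺ S B Sl Bp₀) back
      where
      back : lookup (⋃[ S ] B) p₀ ≡ true → lookup S l ≡ true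
      back e with lookup-⋃⁻ S B e
      ... | l′ , Sl′ , Bl′ with sep Bp₀ Bl′
      ...   | refl = Sl′
  contains? = λ (x : Subset _) → lookup x p₀ Bool.≟ true
  W = filter contains? L
  W⊆ : ∀ {x} → x ∈ W → x ∈ L × lookup x p₀ ≡ true
  W⊆ = ∈-filter⁻ contains?
  uW : Unique W
  uW = Unique.filter⁺ contains? uL
  L⊆W++F : L ⊆ W ++ F false
  L⊆W++F {x} x∈ with lookup x p₀ in eq | ∈-F (L⊆ x∈)
  ... | true  | _  = ∈-++⁺ˡ (∈-filter⁺ contains? x∈ eq)
  ... | false | x∈F = ∈-++⁺ʳ W x∈F
  -- At most half of the 2^k unions avoid the pair, and ¾ - ½ leaves more than a quarter of 2^k for
  -- `W`.
  2^e<∣W∣ : 2 ^ e < length W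
  2^e<∣W∣ = *-cancelˡ-< 4 (2 ^ e) (length W) (+-cancelʳ-< (4 * 2 ^ suc e) _ _ (begin-strict
    4 * 2 ^ e + 4 * 2 ^ suc e         ≡⟨ cong (4 * 2 ^ e +_) (*-assoc 4 2 (2 ^ e)) ⟨
    4 * 2 ^ e + 8 * 2 ^ e             ≡⟨ *-distribʳ-+ (2 ^ e) 4 8 ⟨
    12 * 2 ^ e                        ≡⟨ *-assoc 3 4 (2 ^ e) ⟩
    3 * (4 * 2 ^ e)                   ≡⟨ cong (3 *_) (*-assoc 2 2 (2 ^ e)) ⟩
    3 * 2 ^ suc (suc e)               <⟨ big ⟩
    4 * length L                      ≤⟨ *-monoʳ-≤ 4 (unique⇒length≤ uL L⊆W++F) ⟩
    4 * length (W ++ F false)         ≡⟨ cong (4 *_) (trans (length-++ W) (cong (length W +_) (length-F false))) ⟩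
    4 * (length W + 2 ^ suc e)        ≡⟨ *-distribˡ-+ 4 (length W) (2 ^ suc e) ⟩
    4 * length W + 4 * 2 ^ suc e      ∎))
  U = ⋃[ ⊤ ] B
  lookup-U : ∀ {j p} → lookup (B j) p ≡ true → lookup U p ≡ true
  lookup-U {j} Bp = lookup-⋃⁺ ⊤ B (lookup-replicate j true) Bp
  τ : Subset _ → Subset _
  τ y = y ⊕ (U ⊕ B l)
  lookup-τ : ∀ y p → lookup (τ y) p ≡ lookup y p xor (lookup U p xor lookup (B l) p)
  lookup-τ y p = trans (lookup-⊕ y _ p) (cong (lookup y p xor_) (lookup-⊕ U (B l) p))
  constant-B : Constant B (B l)
  constant-B {j} {p} {q} Bp Bq = true-ext (λ e → subst (λ i → lookup (B i) q ≡ true) (sep Bp e) Bq)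
    (λ e → subst (λ i → lookup (B i) p ≡ true) (sep Bq e) Bp)
  covered : ∀ {y} → Union B y → ∀ {p} → lookup y p ≡ true → ∃ λ j → lookup (B j) p ≡ true
  covered (S , refl) e with lookup-⋃⁻ S B e
  ... | j , _ , Bj = j , Bj
  τ-union : ∀ {y} → Union B y → Union B (τ y)
  τ-union {y} uy = constant⇒union
    (constant-⊕ {B = B} {y} {U ⊕ B l} (union⇒constant sep uy)
      (constant-⊕ {B = B} {U} {B l} (union⇒constant {B = B} {U} sep (⊤ , refl)) constant-B))
    λ {p} e → [ covered uy , (λ e′ → [ covered (⊤ , refl) , (l ,_) ]′
      (xor-true⁻ {lookup U p} (trans (sym (lookup-⊕ U (B l) p)) e′))) ]′
      (xor-true⁻ {lookup y p} (trans (sym (lookup-⊕ y (U ⊕ B l) p)) e))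
  W++τW⊆ : W ++ map τ W ⊆ F true
  W++τW⊆ x∈ with ∈-++⁻ W x∈
  ... | inj₁ x∈W = subst (λ b → _ ∈ F b) (proj₂ (W⊆ x∈W)) (∈-F (L⊆ (proj₁ (W⊆ x∈W))))
  ... | inj₂ x∈τ with ∈-map⁻ τ x∈τ
  ...   | y , y∈ , refl = subst (λ b → τ y ∈ F b)
    (trans (lookup-τ y p₀) (cong₂ _xor_ (proj₂ (W⊆ y∈)) (cong₂ _xor_ (lookup-U Bp₀) Bp₀)))
    (∈-F (τ-union (L⊆ (proj₁ (W⊆ y∈)))))
  y≢τy : ∀ y → y ≢ τ y
  -- `τ` flips membership of every block other than `B l`; such a block exists because there are at
  -- least two.
  y≢τy y eq with another l
  ... | l′ , l′≢l with ∣∣≡2⇒nonempty (B l′) (size l′)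
  ...   | q , Bq = no-fix (lookup y q) (trans (cong (λ z → lookup z q) eq) (trans (lookup-τ y q)
    (cong (lookup y q xor_) (cong₂ _xor_ (lookup-U Bq) (≢true⇒≡false (l′≢l ∘ sep Bq))))))
    where
    no-fix : ∀ b → b ≢ b xor true
    no-fix true  ()
    no-fix false ()
  result : ∃ λ T → Unique T × T ⊆ L × length T ≡ K × ⋂ T ≡ B l
  result with any? (λ y → τ y ∈? W) W
  ... | no none = contradiction 2^e<∣W∣ (≤⇒≯ (*-cancelˡ-≤ 2 (begin
    2 * length W                        ≡⟨ cong (length W +_) (+-identityʳ (length W)) ⟩
    length W + length W                 ≡⟨ cong (length W +_) (length-map τ W) ⟨
    length W + length (map τ W)         ≡⟨ length-++ W ⟨
    length (W ++ map τ W)               ≤⟨ unique⇒length≤ (Unique.++⁺ uW (Unique.map⁺ τ-inj uW) disj) W++τW⊆ ⟩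
    length (F true)                     ≡⟨ length-F true ⟩
    2 ^ suc e                           ∎)))
    where
    τ-inj : ∀ {x y} → τ x ≡ τ y → x ≡ y
    τ-inj {x} {y} eq = trans (sym (⊕-cancelʳ x (U ⊕ B l))) (trans (cong (_⊕ (U ⊕ B l)) eq) (⊕-cancelʳ y _))
    disj : Disjoint W (map τ W)
    disj (x∈ , x∈τ) with ∈-map⁻ τ x∈τ
    ... | y , y∈ , refl = none (lose y∈ x∈)
  ... | yes some with find some
  -- The added sets come from `W` and so contain `B l`; the intersection stays the same.
  ...   | y , y∈ , τy∈ with pad {W = W} ((y≢τy y ∷ []) ∷ [] ∷ []) uW 2≤K (≤-trans K≤ (<⇒≤ 2^e<∣W∣))
  ...     | T , uT , len , Q⊆ , from = T , uT , proj₁ ∘ W⊆ ∘ T⊆W , len ,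
    lookup-ext λ p → true-ext ⋂⊆ (λ Bp → lookup-⋂⁺ T λ x∈ →
      let x∈L , xp₀ = W⊆ (T⊆W x∈) in trans (union⇒constant sep (L⊆ x∈L) Bp Bp₀) xp₀)
    where
    T⊆W : T ⊆ W
    T⊆W x∈ with from x∈
    ... | inj₁ (here refl)         = y∈
    ... | inj₁ (there (here refl)) = τy∈
    ... | inj₂ x∈W                 = x∈W
    cancel : ∀ {a u b} → a ≡ true → u ≡ true → a xor (u xor b) ≡ true → b ≡ true
    cancel {b = true} refl refl _ = refl
    ⋂⊆ : ∀ {p} → lookup (⋂ T) p ≡ true → lookup (B l) p ≡ true
    ⋂⊆ {p} e = cancel yp (lookup-U (proj₂ (covered (L⊆ (proj₁ (W⊆ y∈))) yp)))
      (trans (sym (lookup-τ y p)) (lookup-⋂⁻ e (Q⊆ (there (here refl)))))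
      where
      yp = lookup-⋂⁻ e (Q⊆ (here refl))

-- Unsplit pairs and the uncovered point

n≤2^⌈log₂n⌉ : ∀ n → n ≤ 2 ^ ⌈log₂ n ⌉
n≤2^⌈log₂n⌉ = <-rec _ go
  where
  open ≤-Reasoning
  go : ∀ n → (∀ {m} → m < n → m ≤ 2 ^ ⌈log₂ m ⌉) → n ≤ 2 ^ ⌈log₂ n ⌉
  go zero          _  = z≤n
  go (suc zero)    _  = s≤s z≤n
  go (suc (suc n)) ih = begin
    N                                       ≡⟨ ⌊n/2⌋+⌈n/2⌉≡n N ⟨
    ⌊ N /2⌋ + ⌈ N /2⌉                       ≤⟨ +-monoˡ-≤ ⌈ N /2⌉ (⌊n/2⌋≤⌈n/2⌉ N) ⟩
    ⌈ N /2⌉ + ⌈ N /2⌉                       ≡⟨ cong (⌈ N /2⌉ +_) (+-identityʳ ⌈ N /2⌉) ⟨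
    2 * ⌈ N /2⌉                             ≤⟨ *-monoʳ-≤ 2 (ih (⌈n/2⌉<n n)) ⟩
    2 ^ suc ⌈log₂ ⌈ N /2⌉ ⌉                 ≡⟨ cong (λ c → 2 ^ suc c) (⌈log₂⌈n/2⌉⌉≡⌈log₂n⌉∸1 N) ⟩
    2 ^ suc (⌈log₂ N ⌉ ∸ 1)                 ≡⟨ cong (2 ^_) (m+[n∸m]≡n (⌈log₂⌉-mono-≤ {2} {N} (s≤s (s≤s z≤n)))) ⟩
    2 ^ ⌈log₂ N ⌉                           ∎
    where N = suc (suc n)

unique-element : (x : Subset n) → ∣ x ∣ ≡ 1 → ∃ λ i → lookup x i ≡ true × (∀ {p} → lookup x p ≡ true → p ≡ i)
unique-element (true ∷ x) e = zero , refl , λ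
  { {zero}  _  → refl
  ; {suc p} xp → contradiction (nonempty⇒0<∣∣ x xp) (subst (λ c → ¬ (0 < c)) (sym (suc-injective e)) λ ())
  }
unique-element (false ∷ x) e with unique-element x e
... | i , xi , uniq = suc i , xi , λ { {suc p} xp → cong suc (uniq xp) }

⁅⁆-⊕-∪ : (x : Subset n) {i : Fin n} → lookup x i ≡ true → x ≡ (x ⊕ ⁅ i ⁆) ∪ ⁅ i ⁆
⁅⁆-⊕-∪ x {i} xi = lookup-ext λ p → sym (trans (lookup-zipWith _∨_ p (x ⊕ ⁅ i ⁆) ⁅ i ⁆)
  (trans (cong (_∨ lookup ⁅ i ⁆ p) (lookup-⊕ x ⁅ i ⁆ p)) (bits p)))
  where
  bits : ∀ p → (lookup x p xor lookup ⁅ i ⁆ p) ∨ lookup ⁅ i ⁆ p ≡ lookup x p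
  bits p with lookup ⁅ i ⁆ p in e
  ... | false = trans (Bool.∨-identityʳ _) (Bool.xor-identityʳ _)
  ... | true with lookup-⁅⁆⁻ {p = i} {p} e
  ...   | refl = trans (Bool.∨-zeroʳ _) (sym xi)

parity-⁅⁆ : (i : Fin n) → parity ⁅ i ⁆ ≡ true
parity-⁅⁆ i = trans (cong parity (sym (∩-idem ⁅ i ⁆))) (trans (⁅⁆-· i ⁅ i ⁆) (lookup-⁅⁆⁺ i))

-- A subset of even size in a two-point set is empty or everything.
·block⇒constant : {B : Fin k → Subset n} → (∀ l → ∣ B l ∣ ≡ 2) → {x : Subset n} →
  (∀ l → x · B l ≡ false) → Constant B x
·block⇒constant {B = B} size {x} x·B {l} Bp Bq = true-ext (go Bp Bq) (go Bq Bp)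
  where
  go : ∀ {p q} → lookup (B l) p ≡ true → lookup (B l) q ≡ true → lookup x p ≡ true → lookup x q ≡ true
  go {p} {q} Bp Bq xp with lookup x q in xq
  ... | true  = refl
  ... | false = contradiction (≤-trans
    (s≤s (∣⇒≤ {{>-nonZero (nonempty⇒0<∣∣ (x ∩ B l) (lookup-∩⁺ x (B l) p xp Bp))}} (parity-false⇒2∣ (x ∩ B l) (x·B l))))
    (subst (∣ x ∩ B l ∣ <_) (size l) (p⊂q⇒∣p∣<∣q∣ {p = x ∩ B l} {q = B l}
      ( (λ {r} r∈ → lookup⇒[]= r (B l) (proj₂ (lookup-∩⁻ x (B l) r ([]=⇒lookup r∈))))
      , q , lookup⇒[]= q (B l) Bq
      , λ q∈ → contradiction (trans (sym xq) (proj₁ (lookup-∩⁻ x (B l) q ([]=⇒lookup q∈)))) λ ()))))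
    (<-irrefl refl)

perfect⇒pairing : {B : Fin ⌊ n /2⌋ → Subset n} → IsPerfectPairing B → IsPairing B
perfect⇒pairing {B = B} (sep , size) = size , λ i j i≢j → lookup-ext λ p → true-ext
  (λ e → contradiction (sep (proj₁ (lookup-∩⁻ (B i) (B j) p e)) (proj₂ (lookup-∩⁻ (B i) (B j) p e))) i≢j)
  (λ e → contradiction e (lookup-⊥ p))

union-parity : {B : Fin k → Subset n} → IsPerfectPairing B → {x : Subset n} → Union B x → parity x ≡ false
union-parity {B = B} (sep , size) (S , refl) = 2∣⇒parity-false (⋃[ S ] B)
  (subst (2 ∣_) (sym (∣⋃∣≡*∣S∣ {B = B} sep size S)) (m∣m*n ∣ S ∣))

-- With K = k ∸ 1, the K-wise intersection ⋂ T = B l and x ∉ T form a k-wise intersection x ∩ B l.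
eventown⇒constant : ∀ {K} {B : Fin k → Subset n} → IsPerfectPairing B → {𝒜 L : List (Subset n)} →
  (∀ {T} → Unique T → T ⊆ 𝒜 → length T ≡ suc K → parity (⋂ T) ≡ false) → L ⊆ 𝒜 →
  (∀ l → ∃ λ T → Unique T × T ⊆ L × length T ≡ K × ⋂ T ≡ B l) →
  ∀ {x} → x ∈ 𝒜 → Constant B x
eventown⇒constant {B = B} (sep , size) ev L⊆ blocks {x} x∈ = ·block⇒constant {B = B} size {x} even
  where
  even : ∀ l → x · B l ≡ false
  even l with blocks l
  ... | T , uT , T⊆ , len , ⋂T≡ with x ∈? T
  -- Adding `x` would not give distinct sets, but now `x` contains ⋂ T, so it meets `B l` in the
  -- whole pair.
  ...   | yes x∈T = trans (cong parity x∩B≡B) (2∣⇒parity-false (B l) (subst (2 ∣_) (sym (size l)) ∣-refl))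
    where
    x∩B≡B : x ∩ B l ≡ B l
    x∩B≡B = lookup-ext λ p → true-ext (λ e → proj₂ (lookup-∩⁻ x (B l) p e))
      λ e → lookup-∩⁺ x (B l) p (lookup-⋂⁻ (trans (cong (λ y → lookup y p) ⋂T≡) e) x∈T) e
  ...   | no x∉T = trans (cong (λ b → parity (x ∩ b)) (sym ⋂T≡))
    (ev {x ∷ T} (All.tabulate (λ { y∈ refl → x∉T y∈ }) ∷ uT)
      (λ { (here refl) → x∈ ; (there y∈) → L⊆ (T⊆ y∈) }) (cong suc len))

-- The sets of the family containing the uncovered point i number fewer than k, since k of them
-- would meet in i together with a disjoint union of pairs.
odd-case : ∀ {K} {B : Fin ⌊ n /2⌋ → Subset n} → IsPerfectPairing B →
  {A : Fin m → Subset n} → IsKWiseEventown (suc K) A → (∀ j → Constant B (A j)) →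
  {L : List (Subset n)} → Unique L → (∀ {x} → x ∈ L → Union B x) → K ≤ length L →
  ¬ (2 ∣ n) → {i : Fin n} → (∀ l → lookup (B l) i ≢ true) →
  (∀ p → p ≢ i → ∃ λ l → lookup (B l) p ≡ true) → SubfamilyTypeII (suc K) A
odd-case {n = n} {K = K} {B} perfect {A} ev const {L} uL L⊆ K≤ odd {i} i∉ cov =
  odd , B , perfect⇒pairing {B = B} perfect , i ,
  ((λ l i∈ → i∉ l ([]=⇒lookup i∈)) , λ p p≢i → let l , Bp = cov p p≢i in l , lookup⇒[]= p (B l) Bp) ,
  choose (pad uQ uL Q≤K K≤)
  where
  open ≤-Reasoning
  𝒜 = tabulate A
  contains? = λ (x : Subset n) → lookup x i Bool.≟ true
  Z = filter contains? 𝒜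
  uZ : Unique Z
  uZ = Unique.filter⁺ contains? (Unique.tabulate⁺ (proj₁ ev))
  const′ : ∀ {x} → x ∈ 𝒜 → Constant B x
  const′ x∈ with ∈-tabulate⁻ {f = A} x∈
  ... | j , refl = const j
  constant-i : Constant B ⁅ i ⁆
  constant-i {l} {p} {q} Bp Bq = trans (out Bp) (sym (out Bq))
    where
    out : ∀ {p} → lookup (B l) p ≡ true → lookup ⁅ i ⁆ p ≡ false
    out {p} Bp = ≢true⇒≡false λ e → i∉ l (subst (λ r → lookup (B l) r ≡ true) (lookup-⁅⁆⁻ {p = i} {p} e) Bp)
  avoids⇒union : ∀ {x} → Constant B x → lookup x i ≢ true → Union B x
  avoids⇒union c i∉x = constant⇒union c λ {p} xp → cov p λ { refl → i∉x xp }
  remove : ∀ {x} → Constant B x → lookup x i ≡ true → Union B (x ⊕ ⁅ i ⁆)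
  remove {x} c xi = avoids⇒union (constant-⊕ {B = B} {x} {⁅ i ⁆} c constant-i) λ e →
    contradiction (trans (sym e) (trans (lookup-⊕ x ⁅ i ⁆ i) (cong₂ _xor_ xi (lookup-⁅⁆⁺ i)))) λ ()
  Z≤K : length Z ≤ K
  Z≤K with length Z ≤? K
  ... | yes le = le
  ... | no  gt = contradiction (trans (sym even) odd′) λ ()
    where
    T = take (suc K) Z
    T⊆ : ∀ {x} → x ∈ T → x ∈ 𝒜 × lookup x i ≡ true
    T⊆ x∈ = ∈-filter⁻ contains? {xs = 𝒜} (take-⊆ (suc K) Z x∈)
    even : parity (⋂ T) ≡ false
    even = eventown-⋂ ev (Unique.take⁺ (suc K) uZ) (proj₁ ∘ T⊆)
      (trans (length-take (suc K) Z) (m≤n⇒m⊓n≡m (≰⇒> gt)))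
    odd′ : parity (⋂ T) ≡ true
    odd′ = trans (cong parity (sym (⊕-cancelʳ (⋂ T) ⁅ i ⁆))) (trans (parity-⊕ (⋂ T ⊕ ⁅ i ⁆) ⁅ i ⁆)
      (cong₂ _xor_ (union-parity {B = B} perfect (remove {⋂ T} (constant-⋂ {B = B} {T} (const′ ∘ proj₁ ∘ T⊆))
        (lookup-⋂⁺ T (proj₂ ∘ T⊆)))) (parity-⁅⁆ i)))
  -- Type (ii) asks for exactly `K` sets C. Deleting `i` from the members of `Z` may give fewer, and
  -- unions from `L` make up the number.
  Q = map (_⊕ ⁅ i ⁆) Z
  uQ : Unique Q
  uQ = Unique.map⁺ (λ {x} {y} eq → trans (sym (⊕-cancelʳ x ⁅ i ⁆)) (trans (cong (_⊕ ⁅ i ⁆) eq) (⊕-cancelʳ y ⁅ i ⁆))) uZ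
  Q≤K : length Q ≤ K
  Q≤K = subst (_≤ K) (sym (length-map (_⊕ ⁅ i ⁆) Z)) Z≤K
  choose : (∃ λ T → Unique T × length T ≡ K × Q ⊆ T × (∀ {x} → x ∈ T → x ∈ Q ⊎ x ∈ L)) →
    Σ (Fin K → Subset n) λ C → Injective _≡_ _≡_ C × (∀ l → C l ∈𝓑 B) ×
      (∀ j → A j ∈𝓑 B ⊎ ∃ λ l → A j ≡ C l ∪ ⁅ i ⁆)
  choose (T , uT , refl , Q⊆ , from) = List.lookup T , lookup-injective uT , (λ l → union (from (∈-lookup l))) , split
    where
    union : ∀ {x} → x ∈ Q ⊎ x ∈ L → Union B x
    union (inj₂ x∈L) = L⊆ x∈L
    union (inj₁ x∈Q) with ∈-map⁻ (_⊕ ⁅ i ⁆) x∈Q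
    ... | y , y∈ , refl = let y∈𝒜 , yi = ∈-filter⁻ contains? {xs = 𝒜} y∈ in remove (const′ y∈𝒜) yi
    split : ∀ j → A j ∈𝓑 B ⊎ ∃ λ l → A j ≡ List.lookup T l ∪ ⁅ i ⁆
    split j with lookup (A j) i Bool.≟ true
    ... | no  i∉A = inj₁ (avoids⇒union (const j) i∉A)
    ... | yes Aji = inj₂ (Any.index at , trans (⁅⁆-⊕-∪ (A j) Aji) (cong (_∪ ⁅ i ⁆) (Any.lookup-index at)))
      where
      at : A j ⊕ ⁅ i ⁆ ∈ T
      at = Q⊆ (∈-map⁺ (_⊕ ⁅ i ⁆) (∈-filter⁺ contains? (∈-tabulate⁺ {f = A} j) Aji))

-- Parity of n and conclusion

half-cases : ∀ n → n ≡ 2 * ⌊ n /2⌋ ⊎ n ≡ suc (2 * ⌊ n /2⌋)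
half-cases n with m≤n⇒m<n∨m≡n (2*⌊n/2⌋≤n n)
... | inj₂ eq = inj₁ (sym eq)
... | inj₁ lt = inj₂ (≤-antisym (≤-pred (subst (n <_) (*-suc 2 ⌊ n /2⌋) (n<2*[1+⌊n/2⌋] n))) lt)

trilinear⇒pairing : {L : List (Subset n)} → Unique L → Trilinear L → 2 ^ ⌊ n /2⌋ < 2 * length L →
  ∃ λ (B : Fin ⌊ n /2⌋ → Subset n) → IsPerfectPairing B × (∀ {x} → x ∈ L → Union B x)
trilinear⇒pairing uL tri big with trilinear⇒evenRing uL tri big
... | R , ring , L⊆R = evenRing⇒pairing uL ring L⊆R big

pairing⇒type : ∀ {K} {A : Fin m → Subset n} → IsKWiseEventown (suc K) A → 2 ≤ K → 2 ≤ ⌊ n /2⌋ →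
  K ≤ 2 ^ (⌊ n /2⌋ ∸ 2) → {L : List (Subset n)} → Unique L → L ⊆ tabulate A →
  3 * 2 ^ ⌊ n /2⌋ < 4 * length L →
  (B : Fin ⌊ n /2⌋ → Subset n) → IsPerfectPairing B → (∀ {x} → x ∈ L → Union B x) →
  SubfamilyTypeI A ⊎ SubfamilyTypeII (suc K) A
pairing⇒type {n = n} {K} {A} ev 2≤K 2≤h K≤ {L} uL L⊆𝒜 big B perfect L⊆𝓑 = conclude (half-cases n)
  where
  open ≤-Reasoning
  blocks = ⋂≡block {B = B} perfect uL L⊆𝓑 big 2≤h 2≤K K≤
  const : ∀ j → Constant B (A j)
  const j = eventown⇒constant {B = B} perfect (eventown-⋂ ev) L⊆𝒜 blocks (∈-tabulate⁺ {f = A} j)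
  U = ⋃[ ⊤ ] B
  ∣U∣ : ∣ U ∣ ≡ 2 * ⌊ n /2⌋
  ∣U∣ = trans (∣⋃∣≡*∣S∣ {B = B} (proj₁ perfect) (proj₂ perfect) ⊤) (cong (2 *_) (∣⊤∣≡n ⌊ n /2⌋))
  K≤∣L∣ : K ≤ length L
  K≤∣L∣ = *-cancelˡ-≤ 4 (<⇒≤ (begin-strict
    4 * K                   ≤⟨ *-monoʳ-≤ 4 K≤ ⟩
    4 * 2 ^ (⌊ n /2⌋ ∸ 2)   ≡⟨ ^-distribˡ-+-* 2 2 (⌊ n /2⌋ ∸ 2) ⟨
    2 ^ (2 + (⌊ n /2⌋ ∸ 2)) ≡⟨ cong (2 ^_) (m+[n∸m]≡n 2≤h) ⟩
    2 ^ ⌊ n /2⌋             ≤⟨ m≤n*m (2 ^ ⌊ n /2⌋) 3 ⟩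
    3 * 2 ^ ⌊ n /2⌋         <⟨ big ⟩
    4 * length L            ∎))
  conclude : n ≡ 2 * ⌊ n /2⌋ ⊎ n ≡ suc (2 * ⌊ n /2⌋) → SubfamilyTypeI A ⊎ SubfamilyTypeII (suc K) A
  conclude (inj₁ even) = inj₁ (B , perfect⇒pairing {B = B} perfect , λ j →
    constant⇒union {B = B} {A j} (const j) λ {p} _ → cov p)
    where
    cov : ∀ p → ∃ λ l → lookup (B l) p ≡ true
    cov p = let l , _ , Bp = lookup-⋃⁻ ⊤ B
                  (trans (cong (λ x → lookup x p) (∣p∣≡n⇒p≡⊤ {p = U} (trans ∣U∣ (sym even)))) (lookup-replicate p true))
            in l , Bp
  -- Odd n always ends in type (ii), even if no set contains `i`.
  conclude (inj₂ odd) = inj₂ (odd-case {B = B} perfect ev const uL L⊆𝓑 K≤∣L∣ 2∤n i∉ cov)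
    where
    2∤n : ¬ (2 ∣ n)
    2∤n d = contradiction (∣⇒≤ (∣m+n∣m⇒∣n (subst (2 ∣_) (trans odd (+-comm 1 _)) d) (m∣m*n ⌊ n /2⌋))) λ { (s≤s ()) }
    the-point = unique-element (∁ U) (trans (∣∁p∣≡n∸∣p∣ U) (trans (cong₂ _∸_ odd ∣U∣) (m+n∸n≡m 1 (2 * ⌊ n /2⌋))))
    i = proj₁ the-point
    lookup-∁ : ∀ p → lookup (∁ U) p ≡ not (lookup U p)
    lookup-∁ p = lookup-map p not U
    i∉ : ∀ l → lookup (B l) i ≢ true
    i∉ l Bi = contradiction (trans (sym (proj₁ (proj₂ the-point)))
      (trans (lookup-∁ i) (cong not (lookup-⋃⁺ ⊤ B (lookup-replicate l true) Bi)))) λ ()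
    cov : ∀ p → p ≢ i → ∃ λ l → lookup (B l) p ≡ true
    cov p p≢i with lookup U p Bool.≟ true
    ... | yes Up = let l , _ , Bp = lookup-⋃⁻ ⊤ B Up in l , Bp
    ... | no  f  = contradiction
      (proj₂ (proj₂ the-point) (trans (lookup-∁ p) (cong not (≢true⇒≡false f)))) p≢i

theorem1p3 : (k n m : ℕ) → 3 ≤ k → 2 * ⌈log₂ (k ∸ 1) ⌉ + 4 ≤ n →
    (A : Fin m → Subset n) → IsKWiseEventown k A →
    3 * 2 ^ ⌊ n /2⌋ + 4 * ((k ∸ 1) * n) < 4 * m →
    SubfamilyTypeI A ⊎ SubfamilyTypeII k A
theorem1p3 (suc K) n m 3≤k n≥ A ev big
  with strong-core K K (length (tabulate A)) (tabulate A) (Unique.tabulate⁺ (proj₁ ev)) ≤-refl ≤-refl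
    -- The interval from `K` to `suc K` holds the single size k, so the start of the descent is the
    -- hypothesis itself.
    (λ u T⊆ K< ≤k → eventown-⋂ ev u T⊆ (≤-antisym ≤k K<))
... | s , L , tri , _ , uL , L⊆𝒜 , len , strong =
  let B , perfect , L⊆𝓑 = trilinear⇒pairing uL (strong⇒trilinear 3≤k strong) half
  in pairing⇒type ev (≤-pred 3≤k) (≤-trans (m≤n+m 2 _) h≥) K≤ uL L⊆𝒜 large B perfect L⊆𝓑
  where
  open ≤-Reasoning
  h≥ : ⌈log₂ K ⌉ + 2 ≤ ⌊ n /2⌋
  h≥ = ≤-pred (*-cancelˡ-< 2 _ _ (begin-strict
    2 * (⌈log₂ K ⌉ + 2)                   ≡⟨ *-distribˡ-+ 2 ⌈log₂ K ⌉ 2 ⟩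
    2 * ⌈log₂ K ⌉ + 4                     ≤⟨ n≥ ⟩
    n                                     <⟨ n<2*[1+⌊n/2⌋] n ⟩
    2 * suc ⌊ n /2⌋                       ∎))
  -- More than 2^(⌊n/2⌋ - 2) members of `L` contain a given pair, so this inequality leaves room for
  -- `K` of them.
  K≤ : K ≤ 2 ^ (⌊ n /2⌋ ∸ 2)
  K≤ = ≤-trans (n≤2^⌈log₂n⌉ K) (^-monoʳ-≤ 2 (m+n≤o⇒m≤o∸n ⌈log₂ K ⌉ h≥))
  large : 3 * 2 ^ ⌊ n /2⌋ < 4 * length L
  large = +-cancelʳ-< (4 * (K * n)) _ _ (begin-strict
    3 * 2 ^ ⌊ n /2⌋ + 4 * (K * n)         <⟨ big ⟩
    4 * m                                 ≡⟨ cong (4 *_) (length-tabulate A) ⟨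
    4 * length (tabulate A)               ≤⟨ *-monoʳ-≤ 4 len ⟩
    4 * (length L + K * length s)         ≤⟨ *-monoʳ-≤ 4 (+-monoʳ-≤ (length L) (*-monoʳ-≤ K (triangular⇒length≤ tri))) ⟩
    4 * (length L + K * n)                ≡⟨ *-distribˡ-+ 4 (length L) (K * n) ⟩
    4 * length L + 4 * (K * n)            ∎)
  half : 2 ^ ⌊ n /2⌋ < 2 * length L
  half = *-cancelˡ-< 2 _ _ (begin-strict
    2 * 2 ^ ⌊ n /2⌋                       ≤⟨ *-monoˡ-≤ (2 ^ ⌊ n /2⌋) (n≤1+n 2) ⟩
    3 * 2 ^ ⌊ n /2⌋                       <⟨ large ⟩
    4 * length L                          ≡⟨ *-assoc 2 2 (length L) ⟩
    2 * (2 * length L)                    ∎)
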